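{- Let $G$ be a finite group and $\mathcal{S}$ a 2-dimensional simplicial complex whose vertices are elements of $G$, such that $\mathcal{C}=Sc[\mathcal{S},G]$ is a commutative triplet structure. Then \[\lambda(G_{walk}(\mathcal{C}))\le\sqrt{\tfrac12+\tfrac12\,\lambda\big(G_{dual}\,ⓩ\, L\big)}.\]
   Context: For a 2-complex $X$: $X(1)$ is the set of 2-sets contained in a triangle, $X(2)$ the set of triangles; $X$ is $\tilde d$-regular if every edge of $X(1)$ is in exactly $\tilde d$ triangles. $G_{walk}(X)$ is the graph on $X(1)$ where two distinct edges are adjacent iff they lie in a common triangle. $\lambda(\cdot)$ is the maximal non-trivial eigenvalue of the normalized adjacency operator. For $\sigma\subseteq G$, $g\in G$, put $\sigma\cdot g=\{sg:s\in\sigma\}$. $Sc[\mathcal{S},G]=\{\sigma\cdot g:\sigma\in\mathcal{S},g\in G\}$ (a complex on $G$). Let $\mathcal{T}=\mathcal{S}(1)$ and $\mathcal{T}_o$ the set of ordered pairs $(t_1,t_2)$ with $\{t_1,t_2\}\in\mathcal{T}$. $\mathcal{C}$ is a commutative triplet structure (CTS) if: (0) $\{s,s^{ -1}\}\notin\mathcal{S}(1)$ for every vertex $s$ of $\mathcal{S}$; (A) $\mathcal{S}$ is $\tilde d$-regular for some $\tilde d$; (B) $ab=ba$ for all $\{a,b\}\in\mathcal{T}$; (C) $\{a,b\}\in\mathcal{T}\iff\{a^{ -1},b^{ -1}\}\in\mathcal{T}$; (D) for $t\neq t'\in\mathcal{T}_o$, $t_1t_2^{ -1}=t'_1(t'_2)^{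 -1}$ implies $t'_2=t_1^{ -1}$ and $t'_1=t_2^{ -1}$; (E) the 1-skeleton of $\mathcal{S}$ (vertices of $\mathcal{S}$, edges $\mathcal{T}$) is connected. For $\tau=\{a,b\}\in\mathcal{T}$ write $\hat\tau g=abg$ and $\tau^{ -1}=\{a^{ -1},b^{ -1}\}$. $L=G_{walk}(\mathcal{S})$. $G_{dual}$ is the graph on $G$ with edges $\{g,\hat\tau g\}$ for $g\in G,\tau\in\mathcal{T}$. The replacement product on $G\times\mathcal{T}$ has red edges $(g,\tau)\sim(g,\tau')$ for $\tau\sim\tau'$ in $L$, and blue edges $(g,\tau)\sim(\hat\tau g,\tau^{ -1})$; $P_R,P_B$ are the normalized adjacency matrices of red and blue edges. The zig-zag product $G_{dual}ⓩL$ is the graph on $G\times\mathcal{T}$ with normalized adjacency operator $P_RP_BP_R$. -}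

module Defs where

open import Algebra.Bundles using (CommutativeRing)
open import Algebra.Structures using (IsGroup)
import Algebra.Definitions.RawMonoid as RawMonoidDefs
open import Data.Bool.Properties using () renaming (_≟_ to _≟ᵇ_)
open import Data.Fin.Base using (Fin)
open import Data.Fin.Properties using (any?) renaming (_≟_ to _≟ᶠ_)
open import Data.Fin.Subset using (Subset; inside; outside; _∈_; _⊆_; Nonempty; ⁅_⁆; _∪_; ∣_∣)
open import Data.Fin.Subset.Properties using (_∈?_; _⊆?_; anySubset?)
open import Data.List.Base using (List; []; _∷_; map; _++_; filter; foldr; length; allFin; cartesianProduct)
import Data.List.Membership.Propositional as Membership
open import Data.Nat.Base using (ℕ; zero; suc) renaming (_≤_ to _≤ⁿ_)
open import Data.Nat.Properties using () renaming (_≟_ to _≟ⁿ_)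
open import Data.Product.Base using (∃; ∃-syntax; _×_; _,_)
open import Data.Vec.Base using ([]; _∷_; tabulate)
open import Data.Vec.Properties using (≡-dec)
open import Function.Base using (_∘_)
open import Function.Bundles using (_⇔_)
open import Level using (0ℓ)
open import Relation.Binary.Construct.Closure.ReflexiveTransitive using (Star)
open import Relation.Binary.Core using (Rel)
open import Relation.Binary.Definitions using (Decidable; DecidableEquality)
open import Relation.Binary.PropositionalEquality using (_≡_; _≢_)
open import Relation.Binary.Structures using (IsDecTotalOrder)
open import Relation.Nullary.Decidable using (Dec; does; _×-dec_; ¬?)
open import Relation.Nullary.Negation using (¬_)
open import Relation.Unary using (Pred) renaming (Decidable to Decidable₁)

-- The real numbers, through their characterization as the complete ordered
-- field.  The inverse is total; its value at 0 is left unspecified.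
record RealNumbers : Set₁ where
  field
    commutativeRing : CommutativeRing 0ℓ 0ℓ
  open CommutativeRing commutativeRing public
    using (Carrier; _≈_; _≉_; _+_; _*_; -_; 0#; 1#; +-rawMonoid)
  infix 4 _≤_
  infix 9 _⁻¹
  field
    _≤_             : Rel Carrier 0ℓ
    isDecTotalOrder : IsDecTotalOrder _≈_ _≤_
    +-monoˡ-≤       : ∀ z {x y} → x ≤ y → x + z ≤ y + z
    *-nonNeg        : ∀ {x y} → 0# ≤ x → 0# ≤ y → 0# ≤ x * y
    1≉0             : 1# ≉ 0#
    _⁻¹             : Carrier → Carrier
    ⁻¹-inverseˡ     : ∀ x → x ≉ 0# → x ⁻¹ * x ≈ 1#
    supremum        : (P : Pred Carrier 0ℓ) → ∃ P → (∃[ b ] (∀ x → P x → x ≤ b)) →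
                      ∃[ s ] ((∀ x → P x → x ≤ s) × (∀ b → (∀ x → P x → x ≤ b) → s ≤ b))

  fromℕ : ℕ → Carrier
  fromℕ k = RawMonoidDefs._×_ +-rawMonoid k 1#

  ½ : Carrier
  ½ = fromℕ 2 ⁻¹

  ∑ : {V : Set} → List V → (V → Carrier) → Carrier
  ∑ vs f = foldr (λ v acc → f v + acc) 0# vs

  IsSqrt : Carrier → Carrier → Set
  IsSqrt x s = (0# ≤ s) × (s * s ≈ x)

-- A finite graph whose vertex set consists of the members of a
-- repetition-free list; the values of _∼_ outside it are irrelevant.
record Graph : Set₁ where
  field
    V        : Set
    vertices : List V
    _∼_      : Rel V 0ℓ
    _∼?_     : Decidable _∼_

  neighbours : V → List V
  neighbours v = filter (v ∼?_) vertices

module Spectrum (ℝ : RealNumbers) where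
  open RealNumbers ℝ

  Operator : Set → Set
  Operator V = (V → Carrier) → (V → Carrier)

  normalizedAdjacency : (Γ : Graph) → Operator (Graph.V Γ)
  normalizedAdjacency Γ f v = fromℕ (length nbrs) ⁻¹ * ∑ nbrs f
    where nbrs = Graph.neighbours Γ v

  -- Functions on the vertex set are functions on V, compared on the list vs.
  -- The trivial eigenvalue is the one of the constants.  All operators
  -- below come from regular graphs, so they are self-adjoint for the unweighted
  -- inner product, and the rest of the spectrum, counted with multiplicity,
  -- is that of the restriction to the functions orthogonal to the constants.
  IsNontrivialEigenvalue : {V : Set} → List V → Operator V → Carrier → Set
  IsNontrivialEigenvalue {V} vs M μ =
    ∃[ f ] ((∃[ v ] (v ∈ᵥ vs × f v ≉ 0#))
          × ∑ vs f ≈ 0#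
          × (∀ v → v ∈ᵥ vs → M f v ≈ μ * f v))
    where open Membership {A = V} using () renaming (_∈_ to _∈ᵥ_)

  -- "μ = λ(M)"
  IsMaxNontrivialEigenvalue : {V : Set} → List V → Operator V → Carrier → Set
  IsMaxNontrivialEigenvalue vs M μ =
    IsNontrivialEigenvalue vs M μ × (∀ ν → IsNontrivialEigenvalue vs M ν → ν ≤ μ)

_≟ˢ_ : ∀ {n} → DecidableEquality (Subset n)
_≟ˢ_ = ≡-dec _≟ᵇ_

allSubsets : (n : ℕ) → List (Subset n)
allSubsets zero    = [] ∷ []
allSubsets (suc n) = map (outside ∷_) (allSubsets n) ++ map (inside ∷_) (allSubsets n)

image : ∀ {n} → (Fin n → Fin n) → Subset n → Subset n
image f σ = tabulate λ x → does (any? λ s → (s ∈? σ) ×-dec (f s ≟ᶠ x))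

pair : ∀ {n} → Fin n → Fin n → Subset n
pair a b = ⁅ a ⁆ ∪ ⁅ b ⁆

-- A family of subsets of Fin n; decidability makes it a finite object.
record SetFamily (n : ℕ) : Set₁ where
  field
    Face  : Pred (Subset n) 0ℓ
    face? : Decidable₁ Face

-- Whether the empty set counts as a face is left open.
record Is2DimComplex {n : ℕ} (X : SetFamily n) : Set where
  open SetFamily X
  field
    down-closed : ∀ {σ τ} → Face σ → τ ⊆ σ → Nonempty τ → Face τ
    dim≤2       : ∀ {σ} → Face σ → ∣ σ ∣ ≤ⁿ 3
    dim≥2       : ∃[ σ ] (Face σ × ∣ σ ∣ ≡ 3)

module Faces {n : ℕ} (X : SetFamily n) where
  open SetFamily X

  Vertex : Fin n → Set
  Vertex s = Face ⁅ s ⁆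

  Triangle : Subset n → Set
  Triangle σ = Face σ × ∣ σ ∣ ≡ 3

  triangle? : Decidable₁ Triangle
  triangle? σ = face? σ ×-dec (∣ σ ∣ ≟ⁿ 3)

  Edge : Subset n → Set
  Edge τ = ∣ τ ∣ ≡ 2 × ∃[ σ ] (Triangle σ × τ ⊆ σ)

  edge? : Decidable₁ Edge
  edge? τ = (∣ τ ∣ ≟ⁿ 2) ×-dec anySubset? (λ σ → triangle? σ ×-dec (τ ⊆? σ))

  edges : List (Subset n)
  edges = filter edge? (allSubsets n)

  trianglesOn : Subset n → List (Subset n)
  trianglesOn τ = filter (λ σ → triangle? σ ×-dec (τ ⊆? σ)) (allSubsets n)

  Regular : ℕ → Set
  Regular d = ∀ τ → Edge τ → length (trianglesOn τ) ≡ d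

  Connected : Set
  Connected = ∀ s t → Vertex s → Vertex t → Star (λ a b → Edge (pair a b)) s t

  G-walk : Graph
  G-walk = record
    { V        = Subset n
    ; vertices = edges
    ; _∼_      = λ τ τ′ → τ ≢ τ′ × ∃[ σ ] (Triangle σ × τ ⊆ σ × τ′ ⊆ σ)
    ; _∼?_     = λ τ τ′ → ¬? (τ ≟ˢ τ′) ×-dec
                          anySubset? (λ σ → triangle? σ ×-dec (τ ⊆? σ) ×-dec (τ′ ⊆? σ))
    }

-- A finite group, with elements named by Fin order so that its subsets
-- are those of Data.Fin.Subset.
record FiniteGroup : Set where
  infixl 7 _∙_
  infix  8 _⁻¹
  field
    order   : ℕ
    _∙_     : Fin order → Fin order → Fin order
    ε       : Fin order
    _⁻¹     : Fin order → Fin order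
    isGroup : IsGroup _≡_ _∙_ ε _⁻¹

module CTS (G : FiniteGroup) (S : SetFamily (FiniteGroup.order G)) where
  open FiniteGroup G
  private
    module S = Faces S

  _·_ : Subset order → Fin order → Subset order
  σ · g = image (_∙ g) σ

  Sc : SetFamily order
  Sc = record
    { Face  = λ ρ → ∃[ σ ] (SetFamily.Face S σ × ∃[ g ] ρ ≡ σ · g)
    ; face? = λ ρ → anySubset? (λ σ → SetFamily.face? S σ ×-dec any? (λ g → ρ ≟ˢ (σ · g)))
    }

  𝒯 : Subset order → Set
  𝒯 = S.Edge

  𝒯ₒ : Fin order → Fin order → Set
  𝒯ₒ t₁ t₂ = 𝒯 (pair t₁ t₂)

  record IsCommutativeTripletStructure : Set where
    field
      cond-0 : ∀ s → S.Vertex s → ¬ 𝒯 (pair s (s ⁻¹))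
      cond-A : ∃[ d ] S.Regular d
      cond-B : ∀ a b → 𝒯 (pair a b) → a ∙ b ≡ b ∙ a
      cond-C : ∀ a b → 𝒯 (pair a b) ⇔ 𝒯 (pair (a ⁻¹) (b ⁻¹))
      cond-D : ∀ t₁ t₂ t₁′ t₂′ → 𝒯ₒ t₁ t₂ → 𝒯ₒ t₁′ t₂′ →
               (t₁ , t₂) ≢ (t₁′ , t₂′) →
               t₁ ∙ t₂ ⁻¹ ≡ t₁′ ∙ t₂′ ⁻¹ →
               t₂′ ≡ t₁ ⁻¹ × t₁′ ≡ t₂ ⁻¹
      cond-E : S.Connected

  -- For τ = {a, b} this is abg, with a and b taken in the order of Fin;
  -- by cond-B the order does not matter.
  hat : Subset order → Fin order → Fin order
  hat τ g = foldr _∙_ g (filter (_∈? τ) (allFin order))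

  inv : Subset order → Subset order
  inv = image _⁻¹

  L : Graph
  L = S.G-walk

  -- The red and the blue edges of the replacement product of G_dual and L.
  product-vertices : List (Fin order × Subset order)
  product-vertices = cartesianProduct (allFin order) S.edges

  Red : Graph
  Red = record
    { V        = Fin order × Subset order
    ; vertices = product-vertices
    ; _∼_      = λ { (g , τ) (g′ , τ′) → g ≡ g′ × Graph._∼_ L τ τ′ }
    ; _∼?_     = λ { (g , τ) (g′ , τ′) → (g ≟ᶠ g′) ×-dec Graph._∼?_ L τ τ′ }
    }

  -- Symmetric on product-vertices by cond-B and cond-C.
  Blue : Graph
  Blue = record
    { V        = Fin order × Subset order
    ; vertices = product-vertices
    ; _∼_      = λ { (g , τ) (g′ , τ′) → g′ ≡ hat τ g × τ′ ≡ inv τ }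
    ; _∼?_     = λ { (g , τ) (g′ , τ′) → (g′ ≟ᶠ hat τ g) ×-dec (τ′ ≟ˢ inv τ) }
    }

  module _ (ℝ : RealNumbers) where
    open Spectrum ℝ

    zigzag : Operator (Fin order × Subset order)
    zigzag = P-R ∘ P-B ∘ P-R
      where
      P-R = normalizedAdjacency Red
      P-B = normalizedAdjacency Blue

    IsλWalk : RealNumbers.Carrier ℝ → Set
    IsλWalk = IsMaxNontrivialEigenvalue (Graph.vertices Γ) (normalizedAdjacency Γ)
      where Γ = Faces.G-walk Sc

    IsλZigzag : RealNumbers.Carrier ℝ → Set
    IsλZigzag = IsMaxNontrivialEigenvalue product-vertices zigzag

{-# OPTIONS --safe #-}
module Submission where

-- By (D) and (0), every edge of 𝒞 has exactly two presentations τ · g, and they are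
-- exchanged by the blue matching.  So an eigenfunction f of the walk lifts to
-- F (g , τ) = f (τ · g) with λ₁ F = ½ (H + P_B H), where H = P_R F.  As P_B is a
-- self-adjoint involution,
--   λ₁² ⟨F,F⟩ = ½ ⟨H,H⟩ + ½ ⟨H,P_B H⟩ = ½ ⟨H,H⟩ + ½ ⟨F,P_R P_B P_R F⟩ ≤ ½ ⟨F,F⟩ + ½ λ₂ ⟨F,F⟩,
-- since P_R is a contraction and F is orthogonal to the constants.

open import Defs
open import Algebra.Bundles using (CommutativeRing; Group)
import Algebra.Properties.Group
import Algebra.Properties.Ring
import Algebra.Properties.Semiring.Mult.TCOptimised
import Algebra.Solver.Ring
open import Algebra.Solver.Ring.AlmostCommutativeRing using (fromCommutativeRing; _-Raw-AlmostCommutative⟶_)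
open import Data.Bool.Base using (true; false; if_then_else_)
open import Data.Fin.Base using (Fin; zero; suc)
import Data.Fin.Properties as Fin
open import Data.Fin.Subset using (Subset; inside; outside; _⊆_; ⊥; ⁅_⁆; _∪_; ∣_∣) renaming (_∈_ to _∈ˢ_; _∉_ to _∉ˢ_)
open import Data.Fin.Subset.Properties
  using (_∈?_; _⊆?_; anySubset?; x∈⁅x⁆; x∈⁅y⁆⇒x≡y; x∈p∪q⁻; x∈p∪q⁺; p⊆p∪q; q⊆p∪q; ∪-identityˡ; ∪-identityʳ; ∪-comm;
         ⊆-antisym; ⊆-min; p⊂q⇒∣p∣<∣q∣; p⊆q⇒∣p∣≤∣q∣; ∣⊥∣≡0; ∣⁅x⁆∣≡1; ∉⊥)
open import Data.Integer.Base as ℤ using (ℤ; +_; -[1+_]; _⊖_)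
import Data.Integer.Properties as ℤ
open import Data.List.Base using (List; []; _∷_; map; _++_; filter; foldr; length; allFin)
open import Data.List.Membership.Propositional using (_∈_; find; lose)
open import Data.List.Membership.Propositional.Properties
  using (∈-map⁺; ∈-map⁻; ∈-++⁺ˡ; ∈-++⁺ʳ; ∈-++⁻; ∈-filter⁺; ∈-filter⁻; ∈-allFin; ∈-cartesianProduct⁺; ∈-cartesianProduct⁻)
open import Data.List.Membership.Propositional.Properties.WithK using (unique∧set⇒bag)
open import Data.List.Properties using (length-++; length-map)
open import Data.List.Relation.Binary.BagAndSetEquality using (∼bag⇒↭)
open import Data.List.Relation.Binary.Permutation.Propositional as ↭ using (_↭_)
open import Data.List.Relation.Binary.Permutation.Propositional.Properties using (↭-length)
open import Data.List.Relation.Unary.All as All using (All; []; _∷_)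
import Data.List.Relation.Unary.All.Properties as All
open import Data.List.Relation.Unary.AllPairs using ([]; _∷_)
open import Data.List.Relation.Unary.Any using (any?; here; there)
open import Data.List.Relation.Unary.Unique.Propositional using (Unique)
import Data.List.Relation.Unary.Unique.Propositional.Properties as Unique
open import Data.Maybe.Base using (Maybe; just; nothing)
open import Data.Nat.Base as ℕ using (ℕ; zero; suc)
import Data.Nat.Properties as ℕ
open import Data.Product.Base using (∃-syntax; _×_; _,_; proj₁; proj₂)
open import Data.Product.Properties using (≡-dec)
open import Data.Sum.Base using (_⊎_; inj₁; inj₂; [_,_]′)
open import Data.Vec.Base using ([]; _∷_; here; there)
open import Data.Vec.Properties using (∷-injectiveʳ; lookup∘tabulate; []=⇒lookup; lookup⇒[]=)
open import Function.Base using (_∘_)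
open import Function.Bundles using (mk⇔; Equivalence)
open import Relation.Binary.Definitions using (DecidableEquality)
open import Relation.Binary.PropositionalEquality as ≡ using (_≡_; _≢_)
import Relation.Binary.Reasoning.Setoid as SetoidReasoning
open import Relation.Binary.Structures using (IsDecTotalOrder)
open import Relation.Nullary.Decidable using (Dec; yes; no; does; ¬?; _×-dec_; decidable-stable)
open import Relation.Nullary.Negation using (¬_; contradiction)
open import Relation.Unary using (Decidable)

-- Ordered fields

-- The last inequality of the overview is the variational principle for `λ₂`, but `λ₂` is given only
-- as the largest nontrivial eigenvalue, and the reals only as a complete ordered field. So neither
-- diagonalisation nor compactness is at hand. Completeness supplies a supremum of Rayleigh
-- quotients, and elimination on a finite symmetric matrix shows that this supremum must be an
-- eigenvalue. The decidable order is what permits the case split on each pivot. On the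
-- combinatorial side, the edge conditions have separate tasks. (B) makes the blue partner present
-- the same edge of 𝒞, (C) keeps that partner inside the replacement product, (D) excludes a third
-- presentation and (0) makes the two different. Thus `act` is exactly two-to-one, a sum over the
-- product is twice the sum over the edges, and the lift of a mean-zero function has mean zero. (A)
-- gives all red degrees the same value, so that `P_R` has a symmetric kernel. The factor ½ arises
-- because an edge of 𝒞 has twice as many neighbours as a vertex of `L`.

module IntegerCoefficients {c ℓ} (R : CommutativeRing c ℓ) where
  open CommutativeRing R
  open Algebra.Properties.Ring ring
  open import Algebra.Properties.AbelianGroup +-abelianGroup using (⁻¹-∙-comm)
  open Algebra.Properties.Semiring.Mult.TCOptimised semiring renaming (_×_ to infixl 8 _×′_)
  open SetoidReasoning setoid

  fromℤ : ℤ → Carrier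
  fromℤ (+ n)    = n ×′ 1#
  fromℤ -[1+ n ] = - (suc n ×′ 1#)

  fromℤ-⊖ : ∀ m n → fromℤ (m ⊖ n) ≈ m ×′ 1# + - (n ×′ 1#)
  fromℤ-⊖ m       zero    = sym (trans (+-congˡ -0#≈0#) (+-identityʳ _))
  fromℤ-⊖ zero    (suc n) = sym (+-identityˡ _)
  fromℤ-⊖ (suc m) (suc n) = begin
    fromℤ (suc m ⊖ suc n)                    ≡⟨ ≡.cong fromℤ (ℤ.[1+m]⊖[1+n]≡m⊖n m n) ⟩
    fromℤ (m ⊖ n)                            ≈⟨ fromℤ-⊖ m n ⟩
    m ×′ 1# + - (n ×′ 1#)                      ≈⟨ +-congʳ (+-identityˡ _) ⟨
    0# + m ×′ 1# + - (n ×′ 1#)                 ≈⟨ +-congʳ (+-congʳ (-‿inverseʳ 1#)) ⟨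
    1# + - 1# + m ×′ 1# + - (n ×′ 1#)          ≈⟨ +-congʳ (+-assoc _ _ _) ⟩
    1# + (- 1# + m ×′ 1#) + - (n ×′ 1#)        ≈⟨ +-congʳ (+-congˡ (+-comm _ _)) ⟩
    1# + (m ×′ 1# + - 1#) + - (n ×′ 1#)        ≈⟨ +-congʳ (+-assoc _ _ _) ⟨
    1# + m ×′ 1# + - 1# + - (n ×′ 1#)          ≈⟨ +-assoc _ _ _ ⟩
    1# + m ×′ 1# + (- 1# + - (n ×′ 1#))        ≈⟨ +-cong (sym (1+× m 1#)) (⁻¹-∙-comm _ _) ⟩
    suc m ×′ 1# + - (1# + n ×′ 1#)             ≈⟨ +-congˡ (-‿cong (1+× n 1#)) ⟨
    suc m ×′ 1# + - (suc n ×′ 1#)              ∎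

  fromℤ-+ : ∀ i j → fromℤ (i ℤ.+ j) ≈ fromℤ i + fromℤ j
  fromℤ-+ (+ m)    (+ n)    = ×-homo-+ 1# m n
  fromℤ-+ (+ m)    -[1+ n ] = fromℤ-⊖ m (suc n)
  fromℤ-+ -[1+ m ] (+ n)    = trans (fromℤ-⊖ n (suc m)) (+-comm _ _)
  fromℤ-+ -[1+ m ] -[1+ n ] = begin
    - (suc (suc (m ℕ.+ n)) ×′ 1#)       ≡⟨ ≡.cong (λ k → - (suc k ×′ 1#)) (ℕ.+-suc m n) ⟨
    - ((suc m ℕ.+ suc n) ×′ 1#)         ≈⟨ -‿cong (×-homo-+ 1# (suc m) (suc n)) ⟩
    - (suc m ×′ 1# + suc n ×′ 1#)        ≈⟨ ⁻¹-∙-comm _ _ ⟨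
    - (suc m ×′ 1#) + - (suc n ×′ 1#)    ∎

  fromℤ-neg : ∀ i → fromℤ (ℤ.- i) ≈ - fromℤ i
  fromℤ-neg (+ 0)      = sym -0#≈0#
  fromℤ-neg (+ suc n)  = refl
  fromℤ-neg -[1+ n ]   = sym (-‿involutive _)

  fromℤ-* : ∀ i j → fromℤ (i ℤ.* j) ≈ fromℤ i * fromℤ j
  fromℤ-* (+ m)    (+ n)    = trans (reflexive (≡.cong fromℤ (≡.sym (ℤ.pos-* m n)))) (×1-homo-* m n)
  fromℤ-* (+ m)    -[1+ n ] = begin
    fromℤ (+ m ℤ.* -[1+ n ])           ≡⟨ ≡.cong fromℤ (ℤ.-◃n≡-n (m ℕ.* suc n)) ⟩
    fromℤ (ℤ.- + (m ℕ.* suc n))        ≈⟨ fromℤ-neg (+ (m ℕ.* suc n)) ⟩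
    - ((m ℕ.* suc n) ×′ 1#)             ≈⟨ -‿cong (×1-homo-* m (suc n)) ⟩
    - (m ×′ 1# * suc n ×′ 1#)            ≈⟨ -‿distribʳ-* _ _ ⟩
    m ×′ 1# * - (suc n ×′ 1#)            ∎
  fromℤ-* -[1+ m ] (+ n)    = begin
    fromℤ (-[1+ m ] ℤ.* + n)           ≡⟨ ≡.cong fromℤ (ℤ.-◃n≡-n (suc m ℕ.* n)) ⟩
    fromℤ (ℤ.- + (suc m ℕ.* n))        ≈⟨ fromℤ-neg (+ (suc m ℕ.* n)) ⟩
    - ((suc m ℕ.* n) ×′ 1#)             ≈⟨ -‿cong (×1-homo-* (suc m) n) ⟩
    - (suc m ×′ 1# * n ×′ 1#)            ≈⟨ -‿distribˡ-* _ _ ⟩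
    - (suc m ×′ 1#) * n ×′ 1#            ∎
  fromℤ-* -[1+ m ] -[1+ n ] = begin
    (suc m ℕ.* suc n) ×′ 1#             ≈⟨ ×1-homo-* (suc m) (suc n) ⟩
    suc m ×′ 1# * suc n ×′ 1#            ≈⟨ -‿involutive _ ⟨
    - - (suc m ×′ 1# * suc n ×′ 1#)      ≈⟨ -‿cong (-‿distribˡ-* _ _) ⟩
    - (- (suc m ×′ 1#) * suc n ×′ 1#)    ≈⟨ -‿distribʳ-* _ _ ⟩
    - (suc m ×′ 1#) * - (suc n ×′ 1#)    ∎

  -- Coefficients with decidable equality let the solver cancel numerals and signs in any
  -- commutative ring. The optimised multiple makes `fromℤ (+ 1)` reduce to `1#`, so `con (+ 1)`
  -- matches `1#` in a goal directly.
  morphism : ℤ.+-*-rawRing -Raw-AlmostCommutative⟶ fromCommutativeRing R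
  morphism = record
    { ⟦_⟧    = fromℤ
    ; +-homo = fromℤ-+
    ; *-homo = fromℤ-*
    ; -‿homo = fromℤ-neg
    ; 0-homo = refl
    ; 1-homo = refl
    }

  fromℤ-≟ : ∀ i j → Maybe (fromℤ i ≈ fromℤ j)
  fromℤ-≟ i j with i ℤ.≟ j
  ... | yes i≡j = just (reflexive (≡.cong fromℤ i≡j))
  ... | no  _   = nothing

  open Algebra.Solver.Ring ℤ.+-*-rawRing (fromCommutativeRing R) morphism fromℤ-≟ public
    using (solve; _:=_; _:+_; _:*_; _:-_; :-_; con)

module OrderedField (ℝ : RealNumbers) where
  open RealNumbers ℝ public
  open CommutativeRing commutativeRing public
    using (setoid; refl; sym; trans; reflexive; +-cong; +-congˡ; +-congʳ; *-cong; *-congˡ; *-congʳ; -‿cong;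
           +-identityˡ; +-identityʳ; *-identityˡ; *-identityʳ; -‿inverseʳ; zeroˡ; zeroʳ; +-comm; *-comm; +-assoc; *-assoc;
           distribˡ)
  open IsDecTotalOrder isDecTotalOrder public
    using (_≟_; _≤?_; ≤-resp-≈)
    renaming (reflexive to ≤-reflexive; trans to ≤-trans; antisym to ≤-antisym; total to ≤-total; refl to ≤-refl)
  open IntegerCoefficients commutativeRing public
    using (solve; _:=_; _:+_; _:*_; _:-_; :-_; con)
  open SetoidReasoning setoid

  infix 4 _<_
  _<_ : Carrier → Carrier → Set
  x < y = ¬ y ≤ x

  ≤-respʳ : ∀ {x y z} → y ≈ z → x ≤ y → x ≤ z
  ≤-respʳ = proj₁ ≤-resp-≈

  ≤-respˡ : ∀ {x y z} → y ≈ z → y ≤ x → z ≤ x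
  ≤-respˡ = proj₂ ≤-resp-≈

  ≮⇒≥ : ∀ {x y} → ¬ x < y → y ≤ x
  ≮⇒≥ {x} {y} = decidable-stable (y ≤? x)

  <⇒≤ : ∀ {x y} → x < y → x ≤ y
  <⇒≤ {x} {y} x<y = [ (λ x≤y → x≤y) , (λ y≤x → contradiction y≤x x<y) ]′ (≤-total x y)

  -- Lets the ring solver use a hypothesis `e ≈ f`: the goal is proved modulo `e - f`, with `k` as
  -- the explicit cofactor. Most uses feed in the defining equation of an inverse.
  ≈-modulo : ∀ {e f a b} k → e ≈ f → a ≈ b + k * (e + - f) → a ≈ b
  ≈-modulo {e} {f} {a} {b} k e≈f a≈ = begin
    a                    ≈⟨ a≈ ⟩
    b + k * (e + - f)    ≈⟨ +-congˡ (*-congˡ (+-congʳ e≈f)) ⟩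
    b + k * (f + - f)    ≈⟨ solve 3 (λ b k f → b :+ k :* (f :+ :- f) := b) refl b k f ⟩
    b                    ∎

  0≤y-x⇒x≤y : ∀ {x y} → 0# ≤ y + - x → x ≤ y
  0≤y-x⇒x≤y {x} {y} h = ≤-respˡ (+-identityˡ x)
    (≤-respʳ (solve 2 (λ x y → y :+ :- x :+ x := y) refl x y) (+-monoˡ-≤ x h))

  x≤y⇒0≤y-x : ∀ {x y} → x ≤ y → 0# ≤ y + - x
  x≤y⇒0≤y-x {x} h = ≤-respˡ (-‿inverseʳ x) (+-monoˡ-≤ (- x) h)

  -- The form of most inequalities below: a certificate `d`, built from squares and products of
  -- nonnegative terms, which the solver identifies with the difference.
  ≤-by : ∀ {x y d} → 0# ≤ d → y + - x ≈ d → x ≤ y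
  ≤-by 0≤d eq = 0≤y-x⇒x≤y (≤-respʳ (sym eq) 0≤d)

  +-nonNeg : ∀ {x y} → 0# ≤ x → 0# ≤ y → 0# ≤ x + y
  +-nonNeg {x} {y} 0≤x 0≤y = ≤-trans 0≤y (≤-respˡ (+-identityˡ y) (+-monoˡ-≤ y 0≤x))

  +-mono-≤ : ∀ {x y u v} → x ≤ y → u ≤ v → x + u ≤ y + v
  +-mono-≤ {x} {y} {u} {v} x≤y u≤v = ≤-by (+-nonNeg (x≤y⇒0≤y-x x≤y) (x≤y⇒0≤y-x u≤v))
    (solve 4 (λ x y u v → (y :+ v) :+ :- (x :+ u) := (y :+ :- x) :+ (v :+ :- u)) refl x y u v)

  *-monoʳ-≤ : ∀ {c x y} → 0# ≤ c → x ≤ y → c * x ≤ c * y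
  *-monoʳ-≤ {c} {x} {y} 0≤c x≤y = ≤-by (*-nonNeg 0≤c (x≤y⇒0≤y-x x≤y))
    (solve 3 (λ c x y → c :* y :+ :- (c :* x) := c :* (y :+ :- x)) refl c x y)

  x*x-nonNeg : ∀ x → 0# ≤ x * x
  x*x-nonNeg x = [ (λ 0≤x → *-nonNeg 0≤x 0≤x)
                 , (λ x≤0 → let 0≤-x = ≤-respʳ (+-identityˡ (- x)) (x≤y⇒0≤y-x x≤0) in
                            ≤-respʳ (solve 1 (λ x → :- x :* :- x := x :* x) refl x) (*-nonNeg 0≤-x 0≤-x)) ]′
                 (≤-total 0# x)

  0≤1 : 0# ≤ 1#
  0≤1 = ≤-respʳ (*-identityˡ 1#) (x*x-nonNeg 1#)

  0<1 : 0# < 1#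
  0<1 1≤0 = 1≉0 (≤-antisym 1≤0 0≤1)

  0<⇒≉0 : ∀ {x} → 0# < x → x ≉ 0#
  0<⇒≉0 0<x x≈0 = 0<x (≤-reflexive x≈0)

  nonNeg∧≉0⇒0< : ∀ {x} → 0# ≤ x → x ≉ 0# → 0# < x
  nonNeg∧≉0⇒0< 0≤x x≉0 x≤0 = x≉0 (≤-antisym x≤0 0≤x)

  <-≤-trans : ∀ {x y z} → x < y → y ≤ z → x < z
  <-≤-trans x<y y≤z z≤x = x<y (≤-trans y≤z z≤x)

  x<y⇒0<y-x : ∀ {x y} → x < y → 0# < y + - x
  x<y⇒0<y-x {x} {y} x<y y-x≤0 = x<y (≤-by (x≤y⇒0≤y-x y-x≤0)
    (solve 2 (λ x y → x :+ :- y := con (+ 0) :+ :- (y :+ :- x)) refl x y))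

  0≤x⇒0<1+x : ∀ {x} → 0# ≤ x → 0# < 1# + x
  0≤x⇒0<1+x {x} 0≤x = <-≤-trans 0<1 (≤-by 0≤x (solve 2 (λ o x → (o :+ x) :+ :- o := x) refl 1# x))

  ⁻¹-inverseʳ : ∀ x → x ≉ 0# → x * x ⁻¹ ≈ 1#
  ⁻¹-inverseʳ x x≉0 = trans (*-comm _ _) (⁻¹-inverseˡ x x≉0)

  -- The inverse is the square of itself times `x`.
  ⁻¹-nonNeg : ∀ {x} → 0# < x → 0# ≤ x ⁻¹
  ⁻¹-nonNeg {x} 0<x = ≤-respʳ x⁻¹x⁻¹x≈x⁻¹ (*-nonNeg (x*x-nonNeg (x ⁻¹)) (<⇒≤ 0<x))
    where
    x⁻¹x⁻¹x≈x⁻¹ : x ⁻¹ * x ⁻¹ * x ≈ x ⁻¹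
    x⁻¹x⁻¹x≈x⁻¹ = trans (*-assoc _ _ _) (trans (*-congˡ (⁻¹-inverseˡ x (0<⇒≉0 0<x))) (*-identityʳ _))

  *-cancelˡ-≤ : ∀ {c x y} → 0# < c → c * x ≤ c * y → x ≤ y
  *-cancelˡ-≤ {c} {x} {y} 0<c cx≤cy = ≤-respˡ (cancel x) (≤-respʳ (cancel y) (*-monoʳ-≤ (⁻¹-nonNeg 0<c) cx≤cy))
    where
    cancel : ∀ z → c ⁻¹ * (c * z) ≈ z
    cancel z = trans (sym (*-assoc _ _ _)) (trans (*-congʳ (⁻¹-inverseˡ c (0<⇒≉0 0<c))) (*-identityˡ z))

  *-cancelˡ : ∀ {c x y} → c ≉ 0# → c * x ≈ c * y → x ≈ y
  *-cancelˡ {c} {x} {y} c≉0 cx≈cy = trans (sym (cancel x)) (trans (*-congˡ cx≈cy) (cancel y))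
    where
    cancel : ∀ z → c ⁻¹ * (c * z) ≈ z
    cancel z = trans (sym (*-assoc _ _ _)) (trans (*-congʳ (⁻¹-inverseˡ c c≉0)) (*-identityˡ z))

  *-pos : ∀ {x y} → 0# < x → 0# < y → 0# < x * y
  *-pos {x} {y} 0<x 0<y xy≤0 = 0<y (*-cancelˡ-≤ 0<x (≤-respʳ (sym (zeroʳ x)) xy≤0))

  -- If `y < x`, then `-(x - y)²` equals `(y² - x²) + 2y(x - y)`, which is nonnegative, against
  -- positivity of the square. The sign of `x` is left free because an eigenvalue may be negative.
  ≤-sqrt : ∀ {x y} → 0# ≤ y → x * x ≤ y * y → x ≤ y
  ≤-sqrt {x} {y} 0≤y xx≤yy = ≮⇒≥ λ y<x → let 0<x-y = x<y⇒0<y-x y<x in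
    *-pos 0<x-y 0<x-y
      (≤-by (+-nonNeg (x≤y⇒0≤y-x xx≤yy) (+-nonNeg (*-nonNeg 0≤y (<⇒≤ 0<x-y)) (*-nonNeg 0≤y (<⇒≤ 0<x-y))))
        (solve 2 (λ x y → con (+ 0) :+ :- ((x :+ :- y) :* (x :+ :- y))
                          := (y :* y :+ :- (x :* x)) :+ (y :* (x :+ :- y) :+ y :* (x :+ :- y))) refl x y))

  sqrt : ∀ y → 0# ≤ y → ∃[ s ] IsSqrt y s
  sqrt y 0≤y = s , 0≤s , ≤-antisym ss≤y y≤ss
    where
    P : Carrier → Set
    P x = x * x ≤ y

    bound : ∀ x → P x → x ≤ 1# + y
    bound x xx≤y = ≤-sqrt (+-nonNeg 0≤1 0≤y) (≤-trans xx≤y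
      (≤-by (+-nonNeg 0≤1 (+-nonNeg 0≤y (x*x-nonNeg y)))
        (solve 1 (λ y → (con (+ 1) :+ y) :* (con (+ 1) :+ y) :+ :- y := con (+ 1) :+ (y :+ y :* y)) refl y)))

    P0 : P 0#
    P0 = ≤-respˡ (sym (zeroˡ 0#)) 0≤y

    sup = supremum P (0# , P0) (1# + y , bound)
    s = proj₁ sup

    upper : ∀ x → P x → x ≤ s
    upper = proj₁ (proj₂ sup)

    least : ∀ b → (∀ x → P x → x ≤ b) → s ≤ b
    least = proj₂ (proj₂ sup)

    0≤s : 0# ≤ s
    0≤s = upper 0# P0

    -- If y < s², one Newton step from s gives a smaller upper bound.
    ss≤y : s * s ≤ y
    ss≤y = ≮⇒≥ λ y<ss →
      let
        s≉0 : s ≉ 0#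
        s≉0 s≈0 = y<ss (≤-respˡ (sym (trans (*-congʳ s≈0) (zeroˡ s))) 0≤y)
        0<s = nonNeg∧≉0⇒0< 0≤s s≉0
        0<2s = <-≤-trans 0<s (≤-by 0≤s (solve 1 (λ s → (s :+ s) :+ :- s := s) refl s))
        t = (s + s) ⁻¹
        0≤t = ⁻¹-nonNeg 0<2s
        t2s≈1 = ⁻¹-inverseˡ (s + s) (0<⇒≉0 0<2s)
        δ = s * s + - y
        u = s + - (δ * t)
        0≤u : 0# ≤ u
        0≤u = ≤-respʳ (sym (≈-modulo (- s) t2s≈1
                (solve 3 (λ s y t → s :+ :- ((s :* s :+ :- y) :* t)
                   := (s :* s) :* t :+ y :* t :+ (:- s) :* (t :* (s :+ s) :+ :- con (+ 1))) refl s y t)))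
              (+-nonNeg (*-nonNeg (x*x-nonNeg s) 0≤t) (*-nonNeg 0≤y 0≤t))
        y≤uu : y ≤ u * u
        y≤uu = ≤-by (x*x-nonNeg (δ * t)) (≈-modulo (- δ) t2s≈1
                (solve 3 (λ s y t → let δ = s :* s :+ :- y ; u = s :+ :- (δ :* t) in
                   u :* u :+ :- y := (δ :* t) :* (δ :* t) :+ (:- δ) :* (t :* (s :+ s) :+ :- con (+ 1))) refl s y t))
        s≤u = least u (λ x xx≤y → ≤-sqrt 0≤u (≤-trans xx≤y y≤uu))
      in x<y⇒0<y-x y<ss (≤-by (*-nonNeg (<⇒≤ 0<2s) (x≤y⇒0≤y-x s≤u)) (≈-modulo δ t2s≈1
           (solve 3 (λ s y t → let δ = s :* s :+ :- y ; u = s :+ :- (δ :* t) in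
              con (+ 0) :+ :- δ := (s :+ s) :* (u :+ :- s) :+ δ :* (t :* (s :+ s) :+ :- con (+ 1))) refl s y t)))

    -- If `s² < y`, a larger element of `P` is `s + ε` with `ε = δ / (1 + 2s + δ)`. Since
    -- `δ = ε (1 + r)`, the slack `y - (s + ε)²` comes out as `ε + ε² r`.
    y≤ss : y ≤ s * s
    y≤ss = ≮⇒≥ λ ss<y →
      let
        δ = y + - (s * s)
        0≤δ = <⇒≤ (x<y⇒0<y-x ss<y)
        r = s + s + δ
        0≤r = +-nonNeg (+-nonNeg 0≤s 0≤s) 0≤δ
        0<c = 0≤x⇒0<1+x 0≤r
        t = (1# + r) ⁻¹
        0≤t = ⁻¹-nonNeg 0<c
        tc≈1 = ⁻¹-inverseˡ (1# + r) (0<⇒≉0 0<c)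
        ε = δ * t
        0≤ε = *-nonNeg 0≤δ 0≤t
        s+ε∈P : P (s + ε)
        s+ε∈P = ≤-by (+-nonNeg 0≤ε (*-nonNeg 0≤ε (*-nonNeg 0≤ε 0≤r))) (≈-modulo (- δ + - (ε * δ)) tc≈1
          (solve 3 (λ s y t → let δ = y :+ :- (s :* s) ; r = s :+ s :+ δ ; ε = δ :* t in
             y :+ :- ((s :+ ε) :* (s :+ ε)) := ε :+ ε :* (ε :* r)
               :+ (:- δ :+ :- (ε :* δ)) :* (t :* (con (+ 1) :+ r) :+ :- con (+ 1))) refl s y t))
      in x<y⇒0<y-x ss<y (≤-by (*-nonNeg (<⇒≤ 0<c) (x≤y⇒0≤y-x (upper (s + ε) s+ε∈P))) (≈-modulo δ tc≈1
           (solve 3 (λ s y t → let δ = y :+ :- (s :* s) ; r = s :+ s :+ δ ; ε = δ :* t in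
              con (+ 0) :+ :- δ := (con (+ 1) :+ r) :* (s :+ :- (s :+ ε)) :+ δ :* (t :* (con (+ 1) :+ r) :+ :- con (+ 1))) refl s y t)))

  0≤fromℕ : ∀ n → 0# ≤ fromℕ n
  0≤fromℕ zero    = ≤-refl
  0≤fromℕ (suc n) = +-nonNeg 0≤1 (0≤fromℕ n)

  0<fromℕ : ∀ n → 0# < fromℕ (suc n)
  0<fromℕ n = 0≤x⇒0<1+x (0≤fromℕ n)

  ½+½≈1 : ½ + ½ ≈ 1#
  ½+½≈1 = trans (solve 1 (λ h → h :+ h := h :* (con (+ 1) :+ (con (+ 1) :+ con (+ 0)))) refl ½)
                (⁻¹-inverseˡ (fromℕ 2) (0<⇒≉0 (0<fromℕ 1)))

-- Sums and quadratic forms over finite sets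

-- All counts and reindexings of sums below go through this: a list of neighbours or faces is
-- replaced by an explicit one after comparing members only.
unique∧set⇒↭ : {A : Set} {xs ys : List A} → Unique xs → Unique ys →
               (∀ {x} → x ∈ xs → x ∈ ys) → (∀ {x} → x ∈ ys → x ∈ xs) → xs ↭ ys
unique∧set⇒↭ xs! ys! xs⊆ys ys⊆xs = ∼bag⇒↭ (unique∧set⇒bag xs! ys! (mk⇔ xs⊆ys ys⊆xs))

module Sums (ℝ : RealNumbers) where
  open OrderedField ℝ
  open SetoidReasoning setoid

  𝟙 : ∀ {P : Set} → Dec P → Carrier
  𝟙 P? = if does P? then 1# else 0#

  𝟙-cong : ∀ {P Q : Set} (P? : Dec P) (Q? : Dec Q) → (P → Q) → (Q → P) → 𝟙 P? ≡ 𝟙 Q?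
  𝟙-cong (yes _) (yes _) _ _ = ≡.refl
  𝟙-cong (no _)  (no _)  _ _ = ≡.refl
  𝟙-cong (yes p) (no ¬q) f _ = contradiction (f p) ¬q
  𝟙-cong (no ¬p) (yes q) _ g = contradiction (g q) ¬p

  𝟙-nonNeg : ∀ {P : Set} (P? : Dec P) → 0# ≤ 𝟙 P?
  𝟙-nonNeg (yes _) = 0≤1
  𝟙-nonNeg (no _)  = ≤-refl

  module _ {V : Set} where
    ∑-cong : ∀ vs {f g : V → Carrier} → (∀ v → v ∈ vs → f v ≈ g v) → ∑ vs f ≈ ∑ vs g
    ∑-cong []       f≈g = refl
    ∑-cong (v ∷ vs) f≈g = +-cong (f≈g v (here ≡.refl)) (∑-cong vs (λ u u∈ → f≈g u (there u∈)))

    ∑-mono : ∀ vs {f g : V → Carrier} → (∀ v → v ∈ vs → f v ≤ g v) → ∑ vs f ≤ ∑ vs g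
    ∑-mono []       f≤g = ≤-refl
    ∑-mono (v ∷ vs) f≤g = +-mono-≤ (f≤g v (here ≡.refl)) (∑-mono vs (λ u u∈ → f≤g u (there u∈)))

    ∑-zero : ∀ (vs : List V) → ∑ vs (λ _ → 0#) ≈ 0#
    ∑-zero []       = refl
    ∑-zero (v ∷ vs) = trans (+-identityˡ _) (∑-zero vs)

    ∑-nonNeg : ∀ vs {f : V → Carrier} → (∀ v → v ∈ vs → 0# ≤ f v) → 0# ≤ ∑ vs f
    ∑-nonNeg vs 0≤f = ≤-respˡ (∑-zero vs) (∑-mono vs 0≤f)

    ∑-+ : ∀ vs (f g : V → Carrier) → ∑ vs (λ v → f v + g v) ≈ ∑ vs f + ∑ vs g
    ∑-+ []       f g = sym (+-identityˡ 0#)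
    ∑-+ (v ∷ vs) f g = trans (+-congˡ (∑-+ vs f g))
      (solve 4 (λ a b c d → (a :+ b) :+ (c :+ d) := (a :+ c) :+ (b :+ d)) refl (f v) (g v) (∑ vs f) (∑ vs g))

    ∑-*ˡ : ∀ vs c (f : V → Carrier) → ∑ vs (λ v → c * f v) ≈ c * ∑ vs f
    ∑-*ˡ []       c f = sym (zeroʳ c)
    ∑-*ˡ (v ∷ vs) c f = trans (+-congˡ (∑-*ˡ vs c f)) (sym (distribˡ c _ _))

    ∑-*ʳ : ∀ vs c (f : V → Carrier) → ∑ vs (λ v → f v * c) ≈ ∑ vs f * c
    ∑-*ʳ vs c f = trans (∑-cong vs (λ v _ → *-comm (f v) c)) (trans (∑-*ˡ vs c f) (*-comm c _))

    ∑-one : ∀ (vs : List V) → ∑ vs (λ _ → 1#) ≡ fromℕ (length vs)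
    ∑-one []       = ≡.refl
    ∑-one (v ∷ vs) = ≡.cong (λ s → 1# + s) (∑-one vs)

    ∑-++ : ∀ us vs (f : V → Carrier) → ∑ (us ++ vs) f ≈ ∑ us f + ∑ vs f
    ∑-++ []       vs f = sym (+-identityˡ _)
    ∑-++ (u ∷ us) vs f = trans (+-congˡ (∑-++ us vs f)) (sym (+-assoc _ _ _))

    ∑-↭ : ∀ {us vs} (f : V → Carrier) → us ↭ vs → ∑ us f ≈ ∑ vs f
    ∑-↭ f ↭.refl          = refl
    ∑-↭ f (↭.prep v p)    = +-congˡ (∑-↭ f p)
    ∑-↭ f (↭.swap u v p)  = trans (+-congˡ (+-congˡ (∑-↭ f p)))
      (solve 3 (λ a b c → a :+ (b :+ c) := b :+ (a :+ c)) refl (f u) (f v) _)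
    ∑-↭ f (↭.trans p₁ p₂) = trans (∑-↭ f p₁) (∑-↭ f p₂)

    ∑-filter : ∀ {P : V → Set} (P? : Decidable P) vs (f : V → Carrier) →
               ∑ (filter P? vs) f ≈ ∑ vs (λ v → 𝟙 (P? v) * f v)
    ∑-filter P? []       f = refl
    ∑-filter P? (v ∷ vs) f with does (P? v)
    ... | true  = +-cong (sym (*-identityˡ _)) (∑-filter P? vs f)
    ... | false = trans (∑-filter P? vs f) (trans (sym (+-identityˡ _)) (+-congʳ (sym (zeroˡ _))))

  ∑-map : ∀ {U V : Set} (h : U → V) us (f : V → Carrier) → ∑ (map h us) f ≡ ∑ us (f ∘ h)
  ∑-map h []       f = ≡.refl
  ∑-map h (u ∷ us) f = ≡.cong (λ s → f (h u) + s) (∑-map h us f)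

  ∑-swap : ∀ {U V : Set} us vs (f : U → V → Carrier) →
           ∑ us (λ u → ∑ vs (f u)) ≈ ∑ vs (λ v → ∑ us (λ u → f u v))
  ∑-swap []       vs f = sym (∑-zero vs)
  ∑-swap (u ∷ us) vs f = trans (+-congˡ (∑-swap us vs f)) (sym (∑-+ vs _ _))

  module _ {V : Set} (vs : List V) where
    ⟨_,_⟩ : (V → Carrier) → (V → Carrier) → Carrier
    ⟨ f , g ⟩ = ∑ vs (λ v → f v * g v)

    apply : (V → V → Carrier) → (V → Carrier) → (V → Carrier)
    apply A f u = ∑ vs (λ v → A u v * f v)

    form : (V → V → Carrier) → (V → Carrier) → Carrier
    form A f = ⟨ f , apply A f ⟩

    ⟨⟩-cong : ∀ {f f′ g g′} → (∀ v → v ∈ vs → f v ≈ f′ v) → (∀ v → v ∈ vs → g v ≈ g′ v) → ⟨ f , g ⟩ ≈ ⟨ f′ , g′ ⟩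
    ⟨⟩-cong f≈f′ g≈g′ = ∑-cong vs (λ v v∈ → *-cong (f≈f′ v v∈) (g≈g′ v v∈))

    ⟨⟩-comm : ∀ f g → ⟨ f , g ⟩ ≈ ⟨ g , f ⟩
    ⟨⟩-comm f g = ∑-cong vs (λ v _ → *-comm _ _)

    ⟨⟩-nonNeg : ∀ f → 0# ≤ ⟨ f , f ⟩
    ⟨⟩-nonNeg f = ∑-nonNeg vs (λ v _ → x*x-nonNeg (f v))

    apply-cong : ∀ A {f f′} → (∀ v → v ∈ vs → f v ≈ f′ v) → ∀ u → apply A f u ≈ apply A f′ u
    apply-cong A f≈f′ u = ∑-cong vs (λ v v∈ → *-congˡ (f≈f′ v v∈))

    form-cong : ∀ A {f f′} → (∀ v → v ∈ vs → f v ≈ f′ v) → form A f ≈ form A f′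
    form-cong A f≈f′ = ⟨⟩-cong f≈f′ (λ v _ → apply-cong A f≈f′ v)

-- Definiteness of symmetric forms by elimination

module QuadraticForms (ℝ : RealNumbers) {V : Set} (_≟ᵥ_ : DecidableEquality V) where
  open OrderedField ℝ
  open Sums ℝ
  open SetoidReasoning setoid

  update : (V → Carrier) → V → Carrier → (V → Carrier)
  update f v c u = if does (u ≟ᵥ v) then c else f u

  update-≡ : ∀ f v c → update f v c v ≡ c
  update-≡ f v c with v ≟ᵥ v
  ... | yes _  = ≡.refl
  ... | no v≢v = contradiction ≡.refl v≢v

  update-≢ : ∀ f {v u} c → v ≢ u → update f v c u ≡ f u
  update-≢ f {v} {u} c v≢u with u ≟ᵥ v
  ... | yes u≡v = contradiction (≡.sym u≡v) v≢u
  ... | no _    = ≡.refl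

  update-∉ : ∀ f {v us} c → All (v ≢_) us → ∀ u → u ∈ us → update f v c u ≈ f u
  update-∉ f c v≢us u u∈us = reflexive (update-≢ f c (All.lookup v≢us u∈us))

  δ : V → V → Carrier
  δ v = update (λ _ → 0#) v 1#

  ∑-δ : ∀ {us} (g : V → Carrier) {v} → Unique us → v ∈ us → ∑ us (λ u → g u * δ v u) ≈ g v
  ∑-δ {u ∷ us} g (u≢us ∷ us!) (here ≡.refl) = begin
    g u * δ u u + ∑ us (λ w → g w * δ u w)
      ≈⟨ +-cong (*-congˡ (reflexive (update-≡ _ u 1#)))
                (∑-cong us (λ w w∈ → trans (*-congˡ (update-∉ _ 1# u≢us w w∈)) (zeroʳ (g w)))) ⟩
    g u * 1# + ∑ us (λ _ → 0#)
      ≈⟨ +-cong (*-identityʳ _) (∑-zero us) ⟩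
    g u + 0#
      ≈⟨ +-identityʳ _ ⟩
    g u ∎
  ∑-δ {u ∷ us} g {v} (u≢us ∷ us!) (there v∈us) = begin
    g u * δ v u + ∑ us (λ w → g w * δ v w)
      ≈⟨ +-cong (*-congˡ (reflexive (update-≢ _ 1# (λ v≡u → All.lookup u≢us v∈us (≡.sym v≡u))))) (∑-δ g us! v∈us) ⟩
    g u * 0# + g v
      ≈⟨ +-congʳ (zeroʳ _) ⟩
    0# + g v
      ≈⟨ +-identityˡ _ ⟩
    g v ∎

  Symmetric : (V → V → Carrier) → Set
  Symmetric A = ∀ u v → A u v ≈ A v u

  form-∷ : ∀ {A} → Symmetric A → ∀ v us f → let l = apply us A f v in
           form (v ∷ us) A f ≈ f v * (A v v * f v + l) + (f v * l + form us A f)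
  form-∷ {A} A-sym v us f = +-congˡ (begin
    ∑ us (λ u → f u * (A u v * f v + apply us A f u))
      ≈⟨ ∑-cong us (λ u _ → trans (distribˡ (f u) _ _) (+-congʳ (trans
           (solve 3 (λ a b c → a :* (b :* c) := c :* (b :* a)) refl (f u) (A u v) (f v))
           (*-congˡ (*-congʳ (A-sym u v)))))) ⟩
    ∑ us (λ u → f v * (A v u * f u) + f u * apply us A f u)
      ≈⟨ ∑-+ us _ _ ⟩
    ∑ us (λ u → f v * (A v u * f u)) + form us A f
      ≈⟨ +-congʳ (∑-*ˡ us (f v) _) ⟩
    f v * apply us A f v + form us A f ∎)

  -- Changing the value at a vertex outside `us` leaves the form on `us` alone, so the whole form
  -- becomes a quadratic polynomial in `c`.
  form-update : ∀ {A} → Symmetric A → ∀ {v us} → All (v ≢_) us → ∀ f c → let l = apply us A f v in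
                form (v ∷ us) A (update f v c) ≈ c * (A v v * c + l) + (c * l + form us A f)
  form-update {A} A-sym {v} {us} v≢us f c = trans (form-∷ A-sym v us f′)
    (+-cong (*-cong fv (+-cong (*-congˡ fv) l)) (+-cong (*-cong fv l) (form-cong us A off)))
    where
    f′ = update f v c
    fv = reflexive (update-≡ f v c)
    off = update-∉ f c v≢us
    l = apply-cong us A off v

  apply-δ : ∀ A {us v} → Unique us → v ∈ us → ∀ u → apply us A (δ v) u ≈ A u v
  apply-δ A us! v∈us u = ∑-δ (A u) us! v∈us

  form-δ : ∀ A {us v} → Unique us → v ∈ us → form us A (δ v) ≈ A v v
  form-δ A {us} {v} us! v∈us = trans (⟨⟩-comm us (δ v) _) (trans (∑-δ _ us! v∈us) (apply-δ A us! v∈us v))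

  schur : (V → V → Carrier) → V → Carrier → (V → V → Carrier)
  schur A v i u w = A u w + - (A u v * (i * A v w))

  apply-schur : ∀ A v i us f u → apply us (schur A v i) f u ≈ apply us A f u + - (A u v * (i * apply us A f v))
  apply-schur A v i us f u = begin
    ∑ us (λ w → schur A v i u w * f w)
      ≈⟨ ∑-cong us (λ w _ → solve 5 (λ a b i c f → (a :+ :- (b :* (i :* c))) :* f := a :* f :+ (:- (b :* i)) :* (c :* f))
           refl (A u w) (A u v) i (A v w) (f w)) ⟩
    ∑ us (λ w → A u w * f w + - (A u v * i) * (A v w * f w))
      ≈⟨ ∑-+ us _ _ ⟩
    apply us A f u + ∑ us (λ w → - (A u v * i) * (A v w * f w))
      ≈⟨ +-congˡ (∑-*ˡ us _ _) ⟩
    apply us A f u + - (A u v * i) * apply us A f v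
      ≈⟨ +-congˡ (solve 3 (λ a i l → (:- (a :* i)) :* l := :- (a :* (i :* l))) refl (A u v) i (apply us A f v)) ⟩
    apply us A f u + - (A u v * (i * apply us A f v)) ∎

  form-schur : ∀ {A} → Symmetric A → ∀ v i us f → let l = apply us A f v in
               form us (schur A v i) f ≈ form us A f + - (i * (l * l))
  form-schur {A} A-sym v i us f = begin
    ∑ us (λ u → f u * apply us (schur A v i) f u)
      ≈⟨ ∑-cong us (λ u _ → trans (*-congˡ (trans (apply-schur A v i us f u) (+-congˡ (-‿cong (*-congʳ (A-sym u v))))))
           (solve 5 (λ f a b i l → f :* (a :+ :- (b :* (i :* l))) := f :* a :+ (:- (i :* l)) :* (b :* f)) refl
             (f u) (apply us A f u) (A v u) i l)) ⟩
    ∑ us (λ u → f u * apply us A f u + - (i * l) * (A v u * f u))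
      ≈⟨ ∑-+ us _ _ ⟩
    form us A f + ∑ us (λ u → - (i * l) * (A v u * f u))
      ≈⟨ +-congˡ (∑-*ˡ us _ _) ⟩
    form us A f + - (i * l) * l
      ≈⟨ +-congˡ (solve 2 (λ i l → (:- (i :* l)) :* l := :- (i :* (l :* l))) refl i l) ⟩
    form us A f + - (i * (l * l)) ∎
    where l = apply us A f v

  -- A Cauchy-Schwarz inequality with a crude constant. Only the existence of a bound matters, so
  -- each step uses `(p + q)² ≤ 2p² + 2q²`, which doubles `Λ`.
  functional-bounded : ∀ us (a : V → Carrier) →
    ∃[ Λ ] (0# ≤ Λ × ∀ f → let l = ∑ us (λ u → a u * f u) in l * l ≤ Λ * ⟨_,_⟩ us f f)
  functional-bounded []       a = 0# , ≤-refl , λ f → ≤-refl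
  functional-bounded (v ∷ us) a = let Λ , 0≤Λ , bound = functional-bounded us a in
    (a v * a v + a v * a v) + (Λ + Λ) ,
    +-nonNeg (+-nonNeg (x*x-nonNeg (a v)) (x*x-nonNeg (a v))) (+-nonNeg 0≤Λ 0≤Λ) ,
    λ f → let
      l  = ∑ us (λ u → a u * f u)
      s  = ⟨_,_⟩ us f f
      0≤s = ⟨⟩-nonNeg us f
      r  = x≤y⇒0≤y-x (bound f)
      0≤a²s = *-nonNeg (x*x-nonNeg (a v)) 0≤s
      0≤Λx² = *-nonNeg 0≤Λ (x*x-nonNeg (f v))
    in ≤-by (+-nonNeg (x*x-nonNeg (a v * f v + - l)) (+-nonNeg (+-nonNeg r r) (+-nonNeg (+-nonNeg 0≤a²s 0≤a²s) (+-nonNeg 0≤Λx² 0≤Λx²))))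
      (solve 5 (λ a x l s Λ → let r = Λ :* s :+ :- (l :* l) ; p = (a :* a) :* s ; q = Λ :* (x :* x) in
         ((a :* a :+ a :* a) :+ (Λ :+ Λ)) :* (x :* x :+ s) :+ :- ((a :* x :+ l) :* (a :* x :+ l))
         := (a :* x :+ :- l) :* (a :* x :+ :- l) :+ ((r :+ r) :+ ((p :+ p) :+ (q :+ q)))) refl (a v) (f v) l s Λ)

  -- `Indefinite` means just that a negative value occurs, so negative definite forms are included.
  -- `Coercive` is positive definiteness with a uniform constant; the constant stands on the side of
  -- the form to avoid an inverse.
  Indefinite Singular Coercive : List V → (V → V → Carrier) → Set
  Indefinite vs A = ∃[ f ] form vs A f < 0#
  Singular   vs A = ∃[ f ] ((∃[ v ] (v ∈ vs × f v ≉ 0#)) × (∀ v → v ∈ vs → apply vs A f v ≈ 0#))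
  Coercive   vs A = ∃[ K ] (0# ≤ K × ∀ f → 0# ≤ form vs A f × ⟨_,_⟩ vs f f ≤ K * form vs A f)

  -- Gaussian elimination: a positive pivot is split off by completing the square,
  -- which leaves the Schur complement on the remaining vertices.
  trichotomy : ∀ {vs} → Unique vs → ∀ {A} → Symmetric A → Indefinite vs A ⊎ Singular vs A ⊎ Coercive vs A
  trichotomy {[]}     []           A-sym = inj₂ (inj₂ (0# , ≤-refl , λ f → ≤-refl , ≤-reflexive (sym (zeroˡ 0#))))
  trichotomy {v ∷ us} (v≢us ∷ us!) {A} A-sym with A v v ≟ 0# | 0# ≤? A v v
  ... | no b≉0 | no b<0 = inj₁ (δ v , λ 0≤q → b<0 (≤-respʳ (form-δ A (v≢us ∷ us!) (here ≡.refl)) 0≤q))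
  ... | yes b≈0 | _ with any? (λ u → ¬? (A v u ≟ 0#)) us
  ...   | no  a≈0 = inj₂ (inj₁ (δ v , (v , here ≡.refl , λ δvv≈0 → 1≉0 (trans (reflexive (≡.sym (update-≡ _ v 1#))) δvv≈0))
                      , λ u u∈ → trans (apply-δ A (v≢us ∷ us!) (here ≡.refl) u) (kernel u∈)))
    where
    kernel : ∀ {u} → u ∈ v ∷ us → A u v ≈ 0#
    kernel (here ≡.refl) = b≈0
    kernel {u} (there u∈us) = trans (A-sym u v)
      (decidable-stable (A v u ≟ 0#) (λ a≉0 → a≈0 (lose u∈us a≉0)))
  -- With a zero pivot, the form at the vector with entries `x` at `v` and 1 at `u` is `2 a x + c`,
  -- affine in `x` with nonzero slope. The chosen `x` makes it `-1`.
  ...   | yes a≉0 = inj₁ (update (δ u) v x , λ 0≤q → 0<1 (≤-by (≤-respʳ value 0≤q) refl))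
    where
    found = find a≉0
    u = proj₁ found
    u∈us = proj₁ (proj₂ found)
    a = A v u
    t = a ⁻¹ * ½
    c = A u u
    x = - (t * (c + 1#))
    ta≈½ : t * a ≈ ½
    ta≈½ = trans (solve 3 (λ i h a → (i :* h) :* a := h :* (i :* a)) refl (a ⁻¹) ½ a)
                 (trans (*-congˡ (⁻¹-inverseˡ a (proj₂ (proj₂ found)))) (*-identityʳ ½))
    t2a≈1 : t * a + t * a ≈ 1#
    t2a≈1 = trans (+-cong ta≈½ ta≈½) ½+½≈1
    value : form (v ∷ us) A (update (δ u) v x) ≈ 0# + - 1#
    value = begin
      form (v ∷ us) A (update (δ u) v x)
        ≈⟨ form-update A-sym v≢us (δ u) x ⟩
      x * (A v v * x + apply us A (δ u) v) + (x * apply us A (δ u) v + form us A (δ u))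
        ≈⟨ +-cong (*-congˡ (+-cong (*-congʳ b≈0) (apply-δ A us! u∈us v)))
                  (+-cong (*-congˡ (apply-δ A us! u∈us v)) (form-δ A us! u∈us)) ⟩
      x * (0# * x + a) + (x * a + c)
        ≈⟨ ≈-modulo (- (c + 1#)) t2a≈1 (solve 3 (λ t a c → let x = :- (t :* (c :+ con (+ 1))) in
             x :* (con (+ 0) :* x :+ a) :+ (x :* a :+ c)
             := (con (+ 0) :+ :- con (+ 1)) :+ (:- (c :+ con (+ 1))) :* ((t :* a :+ t :* a) :+ :- con (+ 1))) refl t a c) ⟩
      0# + - 1# ∎
  trichotomy {v ∷ us} (v≢us ∷ us!) {A} A-sym | no b≉0 | yes 0≤b = split (trichotomy us! schur-sym)
    where
    b = A v v
    i = b ⁻¹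
    ib≈1 = ⁻¹-inverseˡ b b≉0
    0≤i = ⁻¹-nonNeg (nonNeg∧≉0⇒0< 0≤b b≉0)
    A′ = schur A v i
    l : (V → Carrier) → Carrier
    l f = apply us A f v

    schur-sym : Symmetric A′
    schur-sym u w = +-cong (A-sym u w) (-‿cong (trans (*-cong (A-sym u v) (*-congˡ (A-sym v w)))
      (solve 3 (λ a i b → a :* (i :* b) := b :* (i :* a)) refl (A v u) i (A w v))))

    complete-square : ∀ f → let y = f v + i * l f in form (v ∷ us) A f ≈ b * (y * y) + form us A′ f
    complete-square f = trans (form-∷ A-sym v us f) (sym (begin
      b * ((x + i * m) * (x + i * m)) + form us A′ f
        ≈⟨ +-congˡ (form-schur A-sym v i us f) ⟩
      b * ((x + i * m) * (x + i * m)) + (q + - (i * (m * m)))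
        ≈⟨ ≈-modulo ((x * m + x * m) + i * (m * m)) ib≈1 (solve 5 (λ b i x m q →
             b :* ((x :+ i :* m) :* (x :+ i :* m)) :+ (q :+ :- (i :* (m :* m)))
             := (x :* (b :* x :+ m) :+ (x :* m :+ q)) :+ ((x :* m :+ x :* m) :+ i :* (m :* m)) :* (i :* b :+ :- con (+ 1)))
             refl b i x m q) ⟩
      x * (b * x + m) + (x * m + q) ∎))
      where
      x = f v
      m = l f
      q = form us A f

    -- The value at `v` makes the completed square vanish. Hence a negative vector or a kernel
    -- vector of the Schur complement extends to one of `A`.
    extend : (V → Carrier) → (V → Carrier)
    extend f = update f v (- (i * l f))

    form-extend : ∀ f → form (v ∷ us) A (extend f) ≈ form us A′ f
    form-extend f = begin
      form (v ∷ us) A (extend f)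
        ≈⟨ complete-square (extend f) ⟩
      b * ((extend f v + i * l (extend f)) * (extend f v + i * l (extend f))) + form us A′ (extend f)
        ≈⟨ +-cong (*-congˡ (*-cong y≈0 y≈0)) (form-cong us A′ off) ⟩
      b * (0# * 0#) + form us A′ f
        ≈⟨ solve 2 (λ b q → b :* (con (+ 0) :* con (+ 0)) :+ q := q) refl b (form us A′ f) ⟩
      form us A′ f ∎
      where
      off = update-∉ f (- (i * l f)) v≢us
      y≈0 : extend f v + i * l (extend f) ≈ 0#
      y≈0 = trans (+-cong (reflexive (update-≡ f v _)) (*-congˡ (apply-cong us A off v)))
                  (solve 1 (λ z → :- z :+ z := con (+ 0)) refl (i * l f))

    apply-extend : ∀ f u → apply (v ∷ us) A (extend f) u ≈ A u v * - (i * l f) + apply us A f u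
    apply-extend f u = +-cong (*-congˡ (reflexive (update-≡ f v _))) (apply-cong us A (update-∉ f _ v≢us) u)

    split : Indefinite us A′ ⊎ Singular us A′ ⊎ Coercive us A′ → _
    split (inj₁ (f , q<0)) = inj₁ (extend f , λ 0≤q → q<0 (≤-respʳ (form-extend f) 0≤q))
    split (inj₂ (inj₁ (f , (u , u∈us , fu≉0) , A′f≈0))) =
      inj₂ (inj₁ (extend f , (u , there u∈us , λ eq → fu≉0 (trans (sym (update-∉ f _ v≢us u u∈us)) eq)) , Af≈0))
      where
      Af≈0 : ∀ w → w ∈ v ∷ us → apply (v ∷ us) A (extend f) w ≈ 0#
      Af≈0 w (here ≡.refl) = trans (apply-extend f v) (≈-modulo (- l f) ib≈1
        (solve 3 (λ b i m → b :* :- (i :* m) :+ m := con (+ 0) :+ (:- m) :* (i :* b :+ :- con (+ 1))) refl b i (l f)))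
      Af≈0 w (there w∈us) = trans (apply-extend f w) (trans
        (solve 4 (λ a i m p → a :* :- (i :* m) :+ p := p :+ :- (a :* (i :* m))) refl (A w v) i (l f) (apply us A f w))
        (trans (sym (apply-schur A v i us f w)) (A′f≈0 w w∈us)))
    -- Since `f v = y - i * l f`, one has `(f v)² ≤ 2y² + 2(i * l f)²`, with slack `z²`. The first
    -- term is `2i (b y²)` because `i * b ≈ 1`, and the second is at most `2 D s`. Adding `s` and
    -- using `s ≤ K q` gives the constant.
    split (inj₂ (inj₂ (K , 0≤K , coercive))) =
      inj₂ (inj₂ ((i + i) + (D + D + 1#) * K ,
        +-nonNeg (+-nonNeg 0≤i 0≤i) (*-nonNeg (+-nonNeg (+-nonNeg 0≤D 0≤D) 0≤1) 0≤K) , bounds))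
      where
      functional = functional-bounded us (A v)
      Λ = proj₁ functional
      0≤Λ = proj₁ (proj₂ functional)
      D = (i * i) * Λ
      0≤D = *-nonNeg (x*x-nonNeg i) 0≤Λ
      bounds : ∀ f → 0# ≤ form (v ∷ us) A f ×
               ⟨_,_⟩ (v ∷ us) f f ≤ ((i + i) + (D + D + 1#) * K) * form (v ∷ us) A f
      bounds f = ≤-respʳ (sym (complete-square f)) (+-nonNeg 0≤by² 0≤q) ,
        ≤-respʳ (*-congˡ (sym (complete-square f)))
          (≤-by (+-nonNeg (x*x-nonNeg z) (+-nonNeg (+-nonNeg D-gap D-gap)
                 (+-nonNeg (*-nonNeg 0≤2D+1 K-gap) (+-nonNeg 0≤2iq (*-nonNeg (*-nonNeg 0≤2D+1 0≤K) 0≤by²)))))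
            (≈-modulo (y * y + y * y) ib≈1 (solve 8 (λ b i x m s Λ K q → let
                y = x :+ i :* m ; D = (i :* i) :* Λ ; e = D :+ D :+ con (+ 1)
                z = x :+ i :* m :+ i :* m ; g = (i :* i) :* (Λ :* s :+ :- (m :* m)) in
              ((i :+ i) :+ e :* K) :* (b :* (y :* y) :+ q) :+ :- (x :* x :+ s)
              := (z :* z :+ ((g :+ g) :+ (e :* (K :* q :+ :- s) :+ ((i :+ i) :* q :+ (e :* K) :* (b :* (y :* y))))))
                 :+ (y :* y :+ y :* y) :* (i :* b :+ :- con (+ 1)))
              refl b i (f v) (l f) s Λ K q)))
        where
        y = f v + i * l f
        z = f v + i * l f + i * l f
        s = ⟨_,_⟩ us f f
        q = form us A′ f
        0≤q = proj₁ (coercive f)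
        K-gap = x≤y⇒0≤y-x (proj₂ (coercive f))
        0≤by² = *-nonNeg 0≤b (x*x-nonNeg y)
        D-gap = *-nonNeg (x*x-nonNeg i) (x≤y⇒0≤y-x (proj₂ (proj₂ functional) f))
        0≤2D+1 = +-nonNeg (+-nonNeg 0≤D 0≤D) 0≤1
        0≤2iq = *-nonNeg (+-nonNeg 0≤i 0≤i) 0≤q

-- Spectra of symmetric stochastic kernels

map-unique : {A B : Set} {f : A → B} {xs : List A} → (∀ {x y} → x ∈ xs → y ∈ xs → f x ≡ f y → x ≡ y) →
             Unique xs → Unique (map f xs)
map-unique f-inj []          = []
map-unique f-inj (x∉ ∷ xs!) =
  All.map⁺ (All.tabulate λ y∈ fx≡fy → All.lookup x∉ y∈ (f-inj (here ≡.refl) (there y∈) fx≡fy))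
  ∷ map-unique (λ x∈ y∈ → f-inj (there x∈) (there y∈)) xs!

module Spectral (ℝ : RealNumbers) {V : Set} (_≟ᵥ_ : DecidableEquality V) (vs : List V) (vs! : Unique vs) where
  open OrderedField ℝ
  open Sums ℝ
  open QuadraticForms ℝ _≟ᵥ_
  open Spectrum ℝ
  open SetoidReasoning setoid

  private
    infix 8 _∙_
    _∙_ : (V → Carrier) → (V → Carrier) → Carrier
    f ∙ g = ⟨_,_⟩ vs f g

    _$_ : (V → V → Carrier) → (V → Carrier) → (V → Carrier)
    K $ f = apply vs K f

  ∙-pos : ∀ {f v} → v ∈ vs → f v ≉ 0# → 0# < f ∙ f
  ∙-pos {f} v∈vs fv≉0 = helper vs v∈vs
    where
    0<fv² : 0# < f _ * f _
    0<fv² = nonNeg∧≉0⇒0< (x*x-nonNeg _) (λ eq → fv≉0 (*-cancelˡ fv≉0 (trans eq (sym (zeroʳ _)))))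
    helper : ∀ us → _ ∈ us → 0# < ⟨_,_⟩ us f f
    helper (u ∷ us) (here ≡.refl) = <-≤-trans 0<fv² (≤-by (⟨⟩-nonNeg us f)
      (solve 2 (λ a b → (a :+ b) :+ :- a := b) refl _ _))
    helper (u ∷ us) (there v∈us)  = <-≤-trans (helper us v∈us) (≤-by (x*x-nonNeg (f u))
      (solve 2 (λ a b → (a :+ b) :+ :- b := a) refl _ _))

  record IsSymmetricStochastic (K : V → V → Carrier) : Set where
    field
      symmetric : Symmetric K
      nonNeg    : ∀ u v → 0# ≤ K u v
      row-sum   : ∀ u → u ∈ vs → ∑ vs (K u) ≈ 1#

    self-adjoint : ∀ f g → f ∙ (K $ g) ≈ (K $ f) ∙ g
    self-adjoint f g = begin
      ∑ vs (λ u → f u * ∑ vs (λ v → K u v * g v))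
        ≈⟨ ∑-cong vs (λ u _ → sym (∑-*ˡ vs (f u) _)) ⟩
      ∑ vs (λ u → ∑ vs (λ v → f u * (K u v * g v)))
        ≈⟨ ∑-swap vs vs _ ⟩
      ∑ vs (λ v → ∑ vs (λ u → f u * (K u v * g v)))
        ≈⟨ ∑-cong vs (λ v _ → trans (∑-cong vs (λ u _ → trans (*-congˡ (*-congʳ (symmetric u v)))
             (solve 3 (λ a b c → a :* (b :* c) := (b :* a) :* c) refl (f u) (K v u) (g v)))) (∑-*ʳ vs (g v) _)) ⟩
      ∑ vs (λ v → (K $ f) v * g v) ∎

    ∑-apply : ∀ f → ∑ vs (K $ f) ≈ ∑ vs f
    ∑-apply f = begin
      ∑ vs (K $ f)                  ≈⟨ ∑-cong vs (λ v _ → *-identityˡ _) ⟨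
      (λ _ → 1#) ∙ (K $ f)          ≈⟨ self-adjoint _ f ⟩
      (K $ (λ _ → 1#)) ∙ f          ≈⟨ ∑-cong vs (λ v v∈ → *-congʳ (trans (∑-cong vs (λ u _ → *-identityʳ _)) (row-sum v v∈))) ⟩
      (λ _ → 1#) ∙ f                ≈⟨ ∑-cong vs (λ v _ → *-identityˡ _) ⟩
      ∑ vs f                        ∎

    -- Expand the nonnegative sum of `K u v * (f u - g v)²`. Row sums turn the squares of `f` into
    -- its norm, and symmetry does the same for `g`.
    bilinear-bound : ∀ f g → f ∙ (K $ g) + f ∙ (K $ g) ≤ f ∙ f + g ∙ g
    bilinear-bound f g = ≤-respˡ lhs (≤-respʳ rhs
      (∑-mono vs (λ u _ → ∑-mono vs (λ v _ → ≤-by (*-nonNeg (nonNeg u v) (x*x-nonNeg (f u + - g v)))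
        (solve 3 (λ k x y → k :* (x :* x) :+ k :* (y :* y) :+ :- (k :* (x :* y) :+ k :* (x :* y))
                            := k :* ((x :+ :- y) :* (x :+ :- y))) refl (K u v) (f u) (g v))))))
      where
      once : ∑ vs (λ u → ∑ vs (λ v → K u v * (f u * g v))) ≈ f ∙ (K $ g)
      once = ∑-cong vs (λ u _ → trans (∑-cong vs (λ v _ →
        solve 3 (λ k x y → k :* (x :* y) := x :* (k :* y)) refl (K u v) (f u) (g v))) (∑-*ˡ vs (f u) _))

      lhs : ∑ vs (λ u → ∑ vs (λ v → K u v * (f u * g v) + K u v * (f u * g v))) ≈ f ∙ (K $ g) + f ∙ (K $ g)
      lhs = trans (∑-cong vs (λ u _ → ∑-+ vs _ _)) (trans (∑-+ vs _ _) (+-cong once once))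

      square : ∀ h → ∑ vs (λ u → ∑ vs (λ v → K u v * (h u * h u))) ≈ h ∙ h
      square h = ∑-cong vs (λ u u∈ → trans (∑-*ʳ vs (h u * h u) _) (trans (*-congʳ (row-sum u u∈)) (*-identityˡ _)))

      rhs : ∑ vs (λ u → ∑ vs (λ v → K u v * (f u * f u) + K u v * (g v * g v))) ≈ f ∙ f + g ∙ g
      rhs = trans (∑-cong vs (λ u _ → ∑-+ vs _ _)) (trans (∑-+ vs _ _) (+-cong (square f)
        (trans (∑-swap vs vs _) (trans (∑-cong vs (λ v _ → ∑-cong vs (λ u _ → *-congʳ (symmetric u v)))) (square g)))))

    form-bound : ∀ f → form vs K f ≤ f ∙ f
    form-bound f = *-cancelˡ-≤ (0<fromℕ 1)
      (≤-respˡ (double _) (≤-respʳ (double _) (bilinear-bound f f)))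
      where
      double : ∀ x → x + x ≈ fromℕ 2 * x
      double = solve 1 (λ x → x :+ x := (con (+ 1) :+ (con (+ 1) :+ con (+ 0))) :* x) refl

    -- The case of `K $ f` against `f` in `bilinear-bound`: one copy of the norm of `K $ f` cancels,
    -- so the contraction property needs no knowledge of the spectrum.
    apply-bound : ∀ f → (K $ f) ∙ (K $ f) ≤ f ∙ f
    apply-bound f = ≤-by (x≤y⇒0≤y-x (bilinear-bound (K $ f) f))
      (solve 2 (λ a b → b :+ :- a := (a :+ b) :+ :- (a :+ a)) refl _ _)

  -- The supremum μ of the Rayleigh quotients of K - CJ, with J the all-ones matrix,
  -- is an eigenvalue of it: otherwise μ - K + CJ is coercive by `trichotomy`.
  -- The shift by C = 2 - lam moves the eigenvalue of the constants below lam.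
  rayleigh : ∀ {K} → IsSymmetricStochastic K → ∀ {T} → (∀ f v → v ∈ vs → T f v ≈ (K $ f) v) →
             ∀ {lam} → (∀ ν → IsNontrivialEigenvalue vs T ν → ν ≤ lam) →
             ∀ F → ∑ vs F ≈ 0# → form vs K F ≤ lam * F ∙ F
  rayleigh {K} K-stochastic {T} T≈K {lam} lam-max F ∑F≈0 = ≮⇒≥ λ gap →
    let
      -- If `lam` exceeded 1, `form-bound` alone would contradict `gap`. This makes the shift `C`
      -- nonnegative.
      λ≤1 : lam ≤ 1#
      λ≤1 = ≮⇒≥ λ 1<λ → gap (≤-trans (form-bound F)
              (≤-respˡ (*-identityˡ _) (scale (⟨⟩-nonNeg vs F) (<⇒≤ 1<λ))))
      0≤C : 0# ≤ C
      0≤C = +-nonNeg 0≤1 (x≤y⇒0≤y-x λ≤1)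

      -- The shift by the all-ones matrix vanishes at `F`, whose sum is zero, so `gap` survives in
      -- `R`.
      P-lam : P lam
      P-lam = F , λ R≤ → gap (≤-respˡ (trans (+-congˡ (-‿cong (*-congˡ (*-cong ∑F≈0 ∑F≈0))))
        (solve 2 (λ a c → a :+ :- (c :* (con (+ 0) :* con (+ 0))) := a) refl _ C)) R≤)

      P-bounded : ∀ t → P t → t ≤ 1#
      P-bounded t (f , R>) = ≮⇒≥ λ 1<t → R> (≤-trans
        (≤-by (*-nonNeg 0≤C (x*x-nonNeg (∑ vs f))) (solve 2 (λ a b → a :+ :- (a :+ :- b) := b) refl _ _))
        (≤-trans (form-bound f) (≤-respˡ (*-identityˡ _) (scale (⟨⟩-nonNeg vs f) (<⇒≤ 1<t)))))

      μ , upper , least = supremum P (lam , P-lam) (1# , P-bounded)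
      λ≤μ = upper lam P-lam

      not-P : ¬ P μ
      not-P = improve μ upper
    in [ (λ { (f , neg) → not-P (f , λ R≤ → neg (≤-respʳ (sym (form-A μ f)) (x≤y⇒0≤y-x R≤))) })
       -- A kernel vector has sum zero, hence is a nontrivial eigenfunction for `μ`, and `μ ≤ lam`.
       -- But `F` has quotient above `lam`, so it would put `μ` into `P`.
       , [ (λ { (f , (v , v∈ , fv≉0) , Af≈0) →
              let
                S≈0 = kernel-sum μ 0≤C λ≤μ f v∈ Af≈0
                eigen = λ u u∈ → trans (T≈K f u u∈) (kernel-eigen μ S≈0 u∈ (Af≈0 u u∈))
                μ≤λ = lam-max μ (f , (v , v∈ , fv≉0) , S≈0 , eigen)
              in not-P (F , λ R≤ → proj₂ P-lam (≤-trans R≤ (scale (⟨⟩-nonNeg vs F) μ≤λ))) })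
         , (λ { (c , 0≤c , coercive) → coercive-gap μ least c 0≤c (λ f → let 0≤q , s≤cq = coercive f in
              ≤-respʳ (form-A μ f) 0≤q , ≤-respʳ (*-congˡ (form-A μ f)) s≤cq) }) ]′ ]′
       (trichotomy vs! (A-sym μ))
    where
    open IsSymmetricStochastic K-stochastic
    C = 1# + (1# + - lam)
    R : (V → Carrier) → Carrier
    R f = form vs K f + - (C * (∑ vs f * ∑ vs f))
    -- The numbers strictly below some Rayleigh quotient of the shifted kernel, written without
    -- division. Strictness excludes functions that vanish on `vs`.
    P : Carrier → Set
    P t = ∃[ f ] t * f ∙ f < R f

    scale : ∀ {s x y} → 0# ≤ s → x ≤ y → x * s ≤ y * s
    scale 0≤s x≤y = ≤-respˡ (*-comm _ _) (≤-respʳ (*-comm _ _) (*-monoʳ-≤ 0≤s x≤y))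

    ⁻¹-pos : ∀ {x} → 0# < x → 0# < x ⁻¹
    ⁻¹-pos {x} 0<x = nonNeg∧≉0⇒0< (⁻¹-nonNeg 0<x) λ x⁻¹≈0 →
      1≉0 (trans (sym (⁻¹-inverseˡ x (0<⇒≉0 0<x))) (trans (*-congʳ x⁻¹≈0) (zeroˡ x)))

    A : Carrier → V → V → Carrier
    A μ u v = μ * δ u v + - K u v + C

    δ-sym : ∀ u v → δ u v ≡ δ v u
    δ-sym u v with v ≟ᵥ u | u ≟ᵥ v
    ... | yes _   | yes _   = ≡.refl
    ... | no  _   | no  _   = ≡.refl
    ... | yes v≡u | no u≢v  = contradiction (≡.sym v≡u) u≢v
    ... | no  v≢u | yes u≡v = contradiction (≡.sym u≡v) v≢u

    A-sym : ∀ μ → Symmetric (A μ)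
    A-sym μ u v = +-congʳ (+-cong (*-congˡ (reflexive (δ-sym u v))) (-‿cong (symmetric u v)))

    apply-A : ∀ μ f {u} → u ∈ vs → (A μ $ f) u ≈ μ * f u + - (K $ f) u + C * ∑ vs f
    apply-A μ f {u} u∈ = begin
      ∑ vs (λ v → (μ * δ u v + - K u v + C) * f v)
        ≈⟨ ∑-cong vs (λ v _ → solve 5 (λ m d k c x → (m :* d :+ :- k :+ c) :* x
             := (m :* (x :* d) :+ (:- con (+ 1)) :* (k :* x)) :+ c :* x) refl μ (δ u v) (K u v) C (f v)) ⟩
      ∑ vs (λ v → (μ * (f v * δ u v) + - 1# * (K u v * f v)) + C * f v)
        ≈⟨ trans (∑-+ vs _ _) (+-cong (trans (∑-+ vs _ _) (+-cong (∑-*ˡ vs μ _) (∑-*ˡ vs (- 1#) _))) (∑-*ˡ vs C f)) ⟩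
      (μ * ∑ vs (λ v → f v * δ u v) + - 1# * (K $ f) u) + C * ∑ vs f
        ≈⟨ +-congʳ (+-cong (*-congˡ (∑-δ f vs! u∈)) (solve 1 (λ x → (:- con (+ 1)) :* x := :- x) refl _)) ⟩
      μ * f u + - (K $ f) u + C * ∑ vs f ∎

    form-A : ∀ μ f → form vs (A μ) f ≈ μ * f ∙ f + - R f
    form-A μ f = begin
      ∑ vs (λ u → f u * (A μ $ f) u)
        ≈⟨ ∑-cong vs (λ u u∈ → trans (*-congˡ (apply-A μ f u∈)) (solve 4 (λ m x k c → x :* (m :* x :+ :- k :+ c)
             := (m :* (x :* x) :+ (:- con (+ 1)) :* (x :* k)) :+ x :* c) refl μ (f u) ((K $ f) u) (C * ∑ vs f))) ⟩
      ∑ vs (λ u → (μ * (f u * f u) + - 1# * (f u * (K $ f) u)) + f u * (C * ∑ vs f))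
        ≈⟨ trans (∑-+ vs _ _) (+-cong (trans (∑-+ vs _ _) (+-cong (∑-*ˡ vs μ _) (∑-*ˡ vs (- 1#) _))) (∑-*ʳ vs _ f)) ⟩
      (μ * f ∙ f + - 1# * form vs K f) + ∑ vs f * (C * ∑ vs f)
        ≈⟨ solve 4 (λ s k c S → (s :+ (:- con (+ 1)) :* k) :+ S :* (c :* S) := s :+ :- (k :+ :- (c :* (S :* S)))) refl
             (μ * f ∙ f) (form vs K f) C (∑ vs f) ⟩
      μ * f ∙ f + - R f ∎

    -- A strict inequality leaves room: raising `μ` by `ε`, the gap divided by `1 + s`, uses up
    -- `ε s` of the gap and leaves exactly `ε`. So no upper bound of `P` belongs to `P`.
    improve : ∀ μ → (∀ t → P t → t ≤ μ) → ¬ P μ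
    improve μ upper (f , gap) = 0<ε (≤-by (x≤y⇒0≤y-x (upper (μ + ε) (f , λ R≤ → 0<ε
        (≤-by (x≤y⇒0≤y-x R≤) (≈-modulo (R f + - (μ * s)) t[1+s]≈1
          (solve 4 (λ m s r t → let e = (r :+ :- (m :* s)) :* t in
             con (+ 0) :+ :- e := ((m :+ e) :* s :+ :- r)
               :+ (r :+ :- (m :* s)) :* (con (+ 1) :+ :- (t :* (con (+ 1) :+ s)))) refl μ s (R f) t))))))
        (solve 2 (λ m e → con (+ 0) :+ :- e := m :+ :- (m :+ e)) refl μ ε))
      where
      s = f ∙ f
      0<1+s = 0≤x⇒0<1+x (⟨⟩-nonNeg vs f)
      t = (1# + s) ⁻¹
      ε = (R f + - (μ * s)) * t
      0<ε = *-pos (x<y⇒0<y-x gap) (⁻¹-pos 0<1+s)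
      t[1+s]≈1 : 1# ≈ t * (1# + s)
      t[1+s]≈1 = sym (⁻¹-inverseˡ (1# + s) (0<⇒≉0 0<1+s))

    length≡suc : ∀ {v} {us : List V} → v ∈ us → ∃[ m ] length us ≡ suc m
    length≡suc {us = _ ∷ us} _ = length us , ≡.refl

    -- Summing the kernel equation over `vs` multiplies `S` by `e`, the eigenvalue of `A μ` on the
    -- constants. Writing the number of vertices as `1 + m` and `C` as `2 - lam`, `e` becomes
    -- `1 + (μ - lam) + m C`, which is positive. This is where the choice of `C` pays off.
    kernel-sum : ∀ μ → 0# ≤ C → lam ≤ μ → ∀ f {v} → v ∈ vs → (∀ u → u ∈ vs → (A μ $ f) u ≈ 0#) → ∑ vs f ≈ 0#
    kernel-sum μ 0≤C λ≤μ f v∈ Af≈0 = *-cancelˡ (0<⇒≉0 0<e) (trans (sym sum-A) (trans (∑-cong vs Af≈0) (trans (∑-zero vs) (sym (zeroʳ _)))))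
      where
      S = ∑ vs f
      m = proj₁ (length≡suc v∈)
      n = fromℕ (length vs)
      e = μ + - 1# + n * C
      0<e : 0# < e
      0<e = <-≤-trans (0≤x⇒0<1+x (+-nonNeg (x≤y⇒0≤y-x λ≤μ) (*-nonNeg (0≤fromℕ m) 0≤C)))
        (≤-reflexive (trans (solve 3 (λ l u m → let c = con (+ 1) :+ (con (+ 1) :+ :- l) in
             con (+ 1) :+ ((u :+ :- l) :+ m :* c) := u :+ :- con (+ 1) :+ (con (+ 1) :+ m) :* c) refl lam μ (fromℕ m))
           (+-congˡ (*-congʳ (reflexive (≡.cong fromℕ (≡.sym (proj₂ (length≡suc v∈)))))))))
      sum-A : ∑ vs (A μ $ f) ≈ e * S
      sum-A = begin
        ∑ vs (A μ $ f)
          ≈⟨ ∑-cong vs (λ u u∈ → trans (apply-A μ f u∈) (solve 3 (λ a b c → a :+ :- b :+ c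
               := (a :+ (:- con (+ 1)) :* b) :+ c :* con (+ 1)) refl _ _ _)) ⟩
        ∑ vs (λ u → (μ * f u + - 1# * (K $ f) u) + C * S * 1#)
          ≈⟨ trans (∑-+ vs _ _) (+-cong (trans (∑-+ vs _ _) (+-cong (∑-*ˡ vs μ f) (∑-*ˡ vs (- 1#) _))) (∑-*ˡ vs _ _)) ⟩
        (μ * S + - 1# * ∑ vs (K $ f)) + C * S * ∑ vs (λ _ → 1#)
          ≈⟨ +-cong (+-congˡ (*-congˡ (∑-apply f))) (*-congˡ (reflexive (∑-one vs))) ⟩
        (μ * S + - 1# * S) + C * S * n
          ≈⟨ solve 4 (λ u s c n → (u :* s :+ (:- con (+ 1)) :* s) :+ c :* s :* n := (u :+ :- con (+ 1) :+ n :* c) :* s) refl μ S C n ⟩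
        e * S ∎

    kernel-eigen : ∀ μ {f u} → ∑ vs f ≈ 0# → u ∈ vs → (A μ $ f) u ≈ 0# → (K $ f) u ≈ μ * f u
    kernel-eigen μ {f} {u} S≈0 u∈ Afu≈0 = begin
      k
        ≈⟨ solve 3 (λ k m z → k := m :+ :- (m :+ :- k :+ z) :+ z) refl k (μ * f u) (C * ∑ vs f) ⟩
      μ * f u + - (μ * f u + - k + C * ∑ vs f) + C * ∑ vs f
        ≈⟨ +-cong (+-congˡ (-‿cong (trans (sym (apply-A μ f u∈)) Afu≈0))) (*-congˡ S≈0) ⟩
      μ * f u + - 0# + C * 0#
        ≈⟨ solve 2 (λ m c → m :+ :- con (+ 0) :+ c :* con (+ 0) := m) refl (μ * f u) C ⟩
      μ * f u ∎
      where k = (K $ f) u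

    -- Coercivity pushes every quotient below `μ` by a fixed amount, so `μ` is not the least upper
    -- bound. The amount is the inverse of `1 + c` rather than of `c`, since `c` may be zero.
    coercive-gap : ∀ μ → (∀ b → (∀ t → P t → t ≤ b) → μ ≤ b) → ∀ c → 0# ≤ c →
                   ¬ (∀ f → 0# ≤ μ * f ∙ f + - R f × f ∙ f ≤ c * (μ * f ∙ f + - R f))
    coercive-gap μ least c 0≤c coercive = ⁻¹-pos 0<1+c (≤-by (x≤y⇒0≤y-x (least (μ + - t) bound))
      (solve 2 (λ m t → con (+ 0) :+ :- t := (m :+ :- t) :+ :- m) refl μ t))
      where
      0<1+c = 0≤x⇒0<1+x 0≤c
      t = (1# + c) ⁻¹
      bound : ∀ x → P x → x ≤ μ + - t
      bound x (f , R>) = ≮⇒≥ λ μ-t<x → R> (≤-trans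
        (*-cancelˡ-≤ 0<1+c (≤-by (+-nonNeg (x≤y⇒0≤y-x (proj₂ (coercive f))) (proj₁ (coercive f)))
          (≈-modulo (f ∙ f) (sym (⁻¹-inverseˡ (1# + c) (0<⇒≉0 0<1+c))) (solve 5 (λ m t s r c →
             (con (+ 1) :+ c) :* ((m :+ :- t) :* s) :+ :- ((con (+ 1) :+ c) :* r)
             := ((c :* (m :* s :+ :- r) :+ :- s) :+ (m :* s :+ :- r)) :+ s :* (con (+ 1) :+ :- (t :* (con (+ 1) :+ c))))
             refl μ t (f ∙ f) (R f) c))))
        (scale (⟨⟩-nonNeg vs f) (<⇒≤ μ-t<x)))

  -- Zig-zag with a perfect matching, the blue step being composition with an involution `β`

  module ZigZag {w} (w-stochastic : IsSymmetricStochastic w)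
                (β : V → V) (β∈ : ∀ {v} → v ∈ vs → β v ∈ vs) (ββ : ∀ {v} → v ∈ vs → β (β v) ≡ v) where
    private
      module w = IsSymmetricStochastic w-stochastic

    ∑-β : ∀ f → ∑ vs (f ∘ β) ≈ ∑ vs f
    ∑-β f = trans (reflexive (≡.sym (∑-map β vs f))) (∑-↭ f (unique∧set⇒↭
      (map-unique (λ x∈ y∈ eq → ≡.trans (≡.sym (ββ x∈)) (≡.trans (≡.cong β eq) (ββ y∈))) vs!) vs!
      (λ x∈ → let y , y∈ , x≡βy = ∈-map⁻ β x∈ in ≡.subst (_∈ vs) (≡.sym x≡βy) (β∈ y∈))
      (λ x∈ → ≡.subst (_∈ map β vs) (ββ x∈) (∈-map⁺ β (β∈ x∈)))))

    kernel : V → V → Carrier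
    kernel u v = (w $ (λ r → w (β r) v)) u

    apply-kernel : ∀ f u → (kernel $ f) u ≈ (w $ ((w $ f) ∘ β)) u
    apply-kernel f u = begin
      ∑ vs (λ v → ∑ vs (λ r → w u r * w (β r) v) * f v)
        ≈⟨ ∑-cong vs (λ v _ → trans (sym (∑-*ʳ vs (f v) _)) (∑-cong vs (λ r _ → *-assoc _ _ _))) ⟩
      ∑ vs (λ v → ∑ vs (λ r → w u r * (w (β r) v * f v)))
        ≈⟨ ∑-swap vs vs _ ⟩
      ∑ vs (λ r → ∑ vs (λ v → w u r * (w (β r) v * f v)))
        ≈⟨ ∑-cong vs (λ r _ → ∑-*ˡ vs (w u r) _) ⟩
      ∑ vs (λ r → w u r * (w $ f) (β r)) ∎

    kernel-stochastic : IsSymmetricStochastic kernel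
    kernel-stochastic = record
      -- Reindexing the sum by `β` moves the matching from one factor to the other.
      { symmetric = λ u v → trans (sym (∑-β _)) (∑-cong vs (λ r r∈ → trans
          (*-cong (w.symmetric u (β r)) (trans (reflexive (≡.cong (λ x → w x v) (ββ r∈))) (w.symmetric r v)))
          (*-comm _ _)))
      ; nonNeg    = λ u v → ∑-nonNeg vs (λ r _ → *-nonNeg (w.nonNeg u r) (w.nonNeg (β r) v))
      ; row-sum   = λ u u∈ → trans (∑-swap vs vs _) (trans (∑-cong vs (λ r r∈ →
          trans (∑-*ˡ vs (w u r) _) (trans (*-congˡ (w.row-sum (β r) (β∈ r∈))) (*-identityʳ _)))) (w.row-sum u u∈))
      }

    half-walk-bound : ∀ {T} → (∀ f v → v ∈ vs → T f v ≈ (w $ ((w $ f) ∘ β)) v) →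
      ∀ {lam} → (∀ ν → IsNontrivialEigenvalue vs T ν → ν ≤ lam) →
      ∀ {F μ} → (∃[ v ] (v ∈ vs × F v ≉ 0#)) → ∑ vs F ≈ 0# →
      (∀ v → v ∈ vs → μ * F v ≈ ½ * ((w $ F) v + (w $ F) (β v))) →
      μ * μ ≤ ½ + ½ * lam
    half-walk-bound {T} T≈ {lam} lam-max {F} {μ} (v , v∈ , Fv≉0) ∑F≈0 eigen =
      *-cancelˡ-≤ (∙-pos v∈ Fv≉0) (≤-respˡ norm
        (≤-by (+-nonNeg (*-nonNeg 0≤½ (x≤y⇒0≤y-x (w.apply-bound F))) (*-nonNeg 0≤½ (x≤y⇒0≤y-x HHβ≤)))
          (solve 5 (λ h s l a b → s :* (h :+ h :* l) :+ :- (h :* (a :+ b))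
             := h :* (s :+ :- a) :+ h :* (l :* s :+ :- b)) refl ½ (F ∙ F) lam (H ∙ H) (H ∙ (H ∘ β)))))
      where
      H = w $ F
      0≤½ = ⁻¹-nonNeg (0<fromℕ 1)

      HHβ≤ : H ∙ (H ∘ β) ≤ lam * F ∙ F
      HHβ≤ = ≤-respˡ (trans (⟨⟩-cong vs (λ _ _ → refl) (λ u _ → apply-kernel F u)) (w.self-adjoint F (H ∘ β)))
        (rayleigh kernel-stochastic (λ f u u∈ → trans (T≈ f u u∈) (sym (apply-kernel f u))) lam-max F ∑F≈0)

      norm : ½ * (H ∙ H + H ∙ (H ∘ β)) ≈ F ∙ F * (μ * μ)
      norm = sym (begin
        F ∙ F * (μ * μ)
          ≈⟨ ∑-*ʳ vs (μ * μ) _ ⟨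
        ∑ vs (λ u → F u * F u * (μ * μ))
          ≈⟨ ∑-cong vs (λ u u∈ → trans (solve 2 (λ f m → f :* f :* (m :* m) := (m :* f) :* (m :* f)) refl (F u) μ)
               (trans (*-cong (eigen u u∈) (eigen u u∈)) (solve 3 (λ h a b → (h :* (a :+ b)) :* (h :* (a :+ b))
                 := (h :* h) :* ((a :* a :+ (a :* b :+ a :* b)) :+ b :* b)) refl ½ (H u) (H (β u))))) ⟩
        ∑ vs (λ u → ½ * ½ * ((H u * H u + (H u * H (β u) + H u * H (β u))) + H (β u) * H (β u)))
          ≈⟨ trans (∑-*ˡ vs (½ * ½) _) (*-congˡ (trans (∑-+ vs _ _) (+-cong (trans (∑-+ vs _ _) (+-congˡ (∑-+ vs _ _))) (∑-β _)))) ⟩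
        ½ * ½ * ((H ∙ H + (H ∙ (H ∘ β) + H ∙ (H ∘ β))) + H ∙ H)
          ≈⟨ ≈-modulo (½ * (H ∙ H + H ∙ (H ∘ β))) ½+½≈1 (solve 3 (λ h a b →
               h :* h :* ((a :+ (b :+ b)) :+ a) := h :* (a :+ b) :+ (h :* (a :+ b)) :* ((h :+ h) :+ :- con (+ 1))) refl ½ (H ∙ H) (H ∙ (H ∘ β))) ⟩
        ½ * (H ∙ H + H ∙ (H ∘ β)) ∎)

-- Edges and triangles

module Subsets where
  open ≡ using (refl; cong; cong₂; sym; trans; subst)

  -- `hat` multiplies the members of an edge in the order of `Fin`, which is unknown for a given `a`
  -- and `b`. This reduces it to two cases, which commutativity then identifies.
  unique-two : {A : Set} {a b : A} {xs : List A} → Unique xs → (∀ {x} → x ∈ xs → x ≡ a ⊎ x ≡ b) →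
               a ∈ xs → b ∈ xs → a ≢ b → xs ≡ a ∷ b ∷ [] ⊎ xs ≡ b ∷ a ∷ []
  unique-two {xs = x ∷ []} _ _ (here refl) (here refl) a≢b = contradiction refl a≢b
  unique-two {xs = x ∷ y ∷ []} ((x≢y ∷ _) ∷ _) only _ _ _ with only (here refl) | only (there (here refl))
  ... | inj₁ refl | inj₁ refl = contradiction refl x≢y
  ... | inj₁ refl | inj₂ refl = inj₁ refl
  ... | inj₂ refl | inj₁ refl = inj₂ refl
  ... | inj₂ refl | inj₂ refl = contradiction refl x≢y
  unique-two {xs = x ∷ y ∷ z ∷ _} ((x≢y ∷ x≢z ∷ _) ∷ (y≢z ∷ _) ∷ _) only _ _ _
    with only (here refl) | only (there (here refl)) | only (there (there (here refl)))
  ... | inj₁ refl | inj₁ refl | _         = contradiction refl x≢y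
  ... | inj₁ refl | inj₂ refl | inj₁ refl = contradiction refl x≢z
  ... | inj₁ refl | inj₂ refl | inj₂ refl = contradiction refl y≢z
  ... | inj₂ refl | inj₂ refl | _         = contradiction refl x≢y
  ... | inj₂ refl | inj₁ refl | inj₂ refl = contradiction refl x≢z
  ... | inj₂ refl | inj₁ refl | inj₁ refl = contradiction refl y≢z

  module _ {n : ℕ} where
    ⊆∧∣∣≡⇒≡ : {p q : Subset n} → p ⊆ q → ∣ p ∣ ≡ ∣ q ∣ → p ≡ q
    ⊆∧∣∣≡⇒≡ {p} {q} p⊆q ∣p∣≡∣q∣ = ⊆-antisym p⊆q q⊆p
      where
      q⊆p : q ⊆ p
      q⊆p {x} x∈q with x ∈? p
      ... | yes x∈p = x∈p
      ... | no  x∉p = contradiction (p⊂q⇒∣p∣<∣q∣ (p⊆q , x , x∈q , x∉p)) (ℕ.<-irrefl ∣p∣≡∣q∣)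

    ∣∣<⇒∃∉ : (p q : Subset n) → ∣ p ∣ ℕ.< ∣ q ∣ → ∃[ x ] (x ∈ˢ q × x ∉ˢ p)
    ∣∣<⇒∃∉ p q ∣p∣<∣q∣ with Fin.any? (λ x → (x ∈? q) ×-dec ¬? (x ∈? p))
    ... | yes found = found
    ... | no  none  = contradiction ∣p∣<∣q∣ (ℕ.≤⇒≯ (p⊆q⇒∣p∣≤∣q∣ q⊆p))
      where
      q⊆p : q ⊆ p
      q⊆p {x} x∈q with x ∈? p
      ... | yes x∈p = x∈p
      ... | no  x∉p = contradiction (x , x∈q , x∉p) none

  ∣p∪⁅x⁆∣ : ∀ {n} (p : Subset n) x → x ∉ˢ p → ∣ p ∪ ⁅ x ⁆ ∣ ≡ suc ∣ p ∣
  ∣p∪⁅x⁆∣ (inside  ∷ p) zero    x∉p = contradiction here x∉p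
  ∣p∪⁅x⁆∣ (outside ∷ p) zero    x∉p = cong (suc ∘ ∣_∣) (∪-identityʳ p)
  ∣p∪⁅x⁆∣ (inside  ∷ p) (suc x) x∉p = cong suc (∣p∪⁅x⁆∣ p x (x∉p ∘ there))
  ∣p∪⁅x⁆∣ (outside ∷ p) (suc x) x∉p = ∣p∪⁅x⁆∣ p x (x∉p ∘ there)

  split-suc : ∀ {n k} (p : Subset n) → ∣ p ∣ ≡ suc k → ∃[ q ] ∃[ x ] (x ∉ˢ q × p ≡ q ∪ ⁅ x ⁆ × ∣ q ∣ ≡ k)
  split-suc (inside  ∷ p) eq = outside ∷ p , zero , (λ ()) , cong (inside ∷_) (sym (∪-identityʳ p)) , ℕ.suc-injective eq
  split-suc (outside ∷ p) eq with split-suc p eq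
  ... | q , x , x∉q , refl , ∣q∣≡k = outside ∷ q , suc x , (λ { (there x∈q) → x∉q x∈q }) , refl , ∣q∣≡k

  allSubsets-complete : ∀ {n} (p : Subset n) → p ∈ allSubsets n
  allSubsets-complete []                    = here refl
  allSubsets-complete (outside ∷ p)         = ∈-++⁺ˡ (∈-map⁺ _ (allSubsets-complete p))
  allSubsets-complete {suc n} (inside ∷ p)  = ∈-++⁺ʳ (map (outside ∷_) (allSubsets n)) (∈-map⁺ _ (allSubsets-complete p))

  allSubsets-unique : ∀ n → Unique (allSubsets n)
  allSubsets-unique zero    = [] ∷ []
  allSubsets-unique (suc n) = Unique.++⁺ (Unique.map⁺ ∷-injectiveʳ (allSubsets-unique n)) (Unique.map⁺ ∷-injectiveʳ (allSubsets-unique n))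
    λ { (p∈ , q∈) → let _ , _ , p≡ = ∈-map⁻ _ p∈ ; _ , _ , q≡ = ∈-map⁻ _ q∈ in contradiction (trans (sym p≡) q≡) λ () }

  module _ {n : ℕ} where
    a∈pair : (a b : Fin n) → a ∈ˢ pair a b
    a∈pair a b = p⊆p∪q ⁅ b ⁆ (x∈⁅x⁆ a)

    b∈pair : (a b : Fin n) → b ∈ˢ pair a b
    b∈pair a b = q⊆p∪q ⁅ a ⁆ ⁅ b ⁆ (x∈⁅x⁆ b)

    ∈pair⁻ : {a b x : Fin n} → x ∈ˢ pair a b → x ≡ a ⊎ x ≡ b
    ∈pair⁻ {a} {b} x∈ = [ inj₁ ∘ x∈⁅y⁆⇒x≡y a , inj₂ ∘ x∈⁅y⁆⇒x≡y b ]′ (x∈p∪q⁻ ⁅ a ⁆ ⁅ b ⁆ x∈)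

    pair-⊆ : {a b : Fin n} {p : Subset n} → a ∈ˢ p → b ∈ˢ p → pair a b ⊆ p
    pair-⊆ a∈p b∈p x∈ with ∈pair⁻ x∈
    ... | inj₁ refl = a∈p
    ... | inj₂ refl = b∈p

    pair-comm : (a b : Fin n) → pair a b ≡ pair b a
    pair-comm a b = ∪-comm ⁅ a ⁆ ⁅ b ⁆

    ∣pair∣ : {a b : Fin n} → a ≢ b → ∣ pair a b ∣ ≡ 2
    ∣pair∣ {a} {b} a≢b = trans (∣p∪⁅x⁆∣ ⁅ a ⁆ b (λ b∈ → a≢b (sym (x∈⁅y⁆⇒x≡y a b∈)))) (cong suc (∣⁅x⁆∣≡1 a))

    ∣pair∣≡2⇒≢ : {a b : Fin n} → ∣ pair a b ∣ ≡ 2 → a ≢ b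
    ∣pair∣≡2⇒≢ {a} ∣∣≡2 refl = ℕ.<⇒≱ (ℕ.≤-refl {2})
      (≡.subst₂ ℕ._≤_ ∣∣≡2 (∣⁅x⁆∣≡1 a) (p⊆q⇒∣p∣≤∣q∣ (pair-⊆ (x∈⁅x⁆ a) (x∈⁅x⁆ a))))

    ∣∣≡0⇒≡⊥ : {p : Subset n} → ∣ p ∣ ≡ 0 → p ≡ ⊥
    ∣∣≡0⇒≡⊥ {p} ∣p∣≡0 = sym (⊆∧∣∣≡⇒≡ (⊆-min p) (trans (∣⊥∣≡0 n) (sym ∣p∣≡0)))

    ∣∣≡2⇒pair : (p : Subset n) → ∣ p ∣ ≡ 2 → ∃[ a ] ∃[ b ] p ≡ pair a b
    ∣∣≡2⇒pair p ∣p∣≡2 with split-suc p ∣p∣≡2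
    ... | q , b , _ , refl , ∣q∣≡1 with split-suc q ∣q∣≡1
    ...   | r , a , _ , refl , ∣r∣≡0 = a , b , cong (_∪ ⁅ b ⁆) (trans (cong (_∪ ⁅ a ⁆) (∣∣≡0⇒≡⊥ ∣r∣≡0)) (∪-identityˡ ⁅ a ⁆))

    ⊆∧∣∣≡suc⇒∪⁅⁆ : {p q : Subset n} → p ⊆ q → ∣ q ∣ ≡ suc ∣ p ∣ → ∃[ x ] (x ∉ˢ p × q ≡ p ∪ ⁅ x ⁆)
    ⊆∧∣∣≡suc⇒∪⁅⁆ {p} {q} p⊆q ∣q∣≡ =
      let x , x∈q , x∉p = ∣∣<⇒∃∉ p q (ℕ.≤-reflexive (sym ∣q∣≡)) in
      x , x∉p , sym (⊆∧∣∣≡⇒≡ (λ y∈ → [ p⊆q , (λ y∈x → subst (_∈ˢ q) (sym (x∈⁅y⁆⇒x≡y x y∈x)) x∈q) ]′ (x∈p∪q⁻ p ⁅ x ⁆ y∈))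
                              (trans (∣p∪⁅x⁆∣ p x x∉p) (sym ∣q∣≡)))

    -- τ contains c, since otherwise it would be {a, b}.
    pair-in-triple : ∀ {a b c} {τ : Subset n} → ∣ pair a b ∣ ≡ 2 → ∣ τ ∣ ≡ 2 → τ ⊆ pair a b ∪ ⁅ c ⁆ → pair a b ≢ τ →
                     τ ≡ pair a c ⊎ τ ≡ pair b c
    pair-in-triple {a} {b} {c} {τ} ∣ab∣≡2 ∣τ∣≡2 τ⊆ ab≢τ with c ∈? τ
    ... | no c∉τ = contradiction (sym (⊆∧∣∣≡⇒≡ τ⊆ab (trans ∣τ∣≡2 (sym ∣ab∣≡2)))) ab≢τ
      where
      τ⊆ab : τ ⊆ pair a b
      τ⊆ab x∈τ with x∈p∪q⁻ (pair a b) ⁅ c ⁆ (τ⊆ x∈τ)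
      ... | inj₁ x∈ab = x∈ab
      ... | inj₂ x∈c  = contradiction (subst (_∈ˢ τ) (x∈⁅y⁆⇒x≡y c x∈c) x∈τ) c∉τ
    ... | yes c∈τ = result (∣∣<⇒∃∉ ⁅ c ⁆ τ (ℕ.≤-reflexive (trans (cong suc (∣⁅x⁆∣≡1 c)) (sym ∣τ∣≡2))))
      where
      τ≡pair : ∀ {x} → x ∈ˢ τ → x ≢ c → τ ≡ pair x c
      τ≡pair x∈τ x≢c = sym (⊆∧∣∣≡⇒≡ (pair-⊆ x∈τ c∈τ) (trans (∣pair∣ x≢c) (sym ∣τ∣≡2)))
      result : ∃[ x ] (x ∈ˢ τ × x ∉ˢ ⁅ c ⁆) → τ ≡ pair a c ⊎ τ ≡ pair b c
      result (x , x∈τ , x∉c) with x∈p∪q⁻ (pair a b) ⁅ c ⁆ (τ⊆ x∈τ)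
      ... | inj₂ x∈c  = contradiction x∈c x∉c
      ... | inj₁ x∈ab with ∈pair⁻ x∈ab
      ...   | inj₁ refl = inj₁ (τ≡pair x∈τ λ { refl → x∉c (x∈⁅x⁆ c) })
      ...   | inj₂ refl = inj₂ (τ≡pair x∈τ λ { refl → x∉c (x∈⁅x⁆ c) })

    ∈image⁺ : (f : Fin n → Fin n) {p : Subset n} {x : Fin n} → x ∈ˢ p → f x ∈ˢ image f p
    ∈image⁺ f {p} {x} x∈p = lookup⇒[]= (f x) (image f p) (trans (lookup∘tabulate _ (f x)) does≡true)
      where
      does≡true : does (Fin.any? λ s → (s ∈? p) ×-dec (f s Fin.≟ f x)) ≡ true
      does≡true with Fin.any? (λ s → (s ∈? p) ×-dec (f s Fin.≟ f x))
      ... | yes _    = refl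
      ... | no  none = contradiction (x , x∈p , refl) none

    ∈image⁻ : (f : Fin n → Fin n) (p : Subset n) {y : Fin n} → y ∈ˢ image f p → ∃[ x ] (x ∈ˢ p × f x ≡ y)
    ∈image⁻ f p {y} y∈ = witness (trans (sym (lookup∘tabulate _ y)) ([]=⇒lookup y∈))
      where
      witness : does (Fin.any? λ s → (s ∈? p) ×-dec (f s Fin.≟ y)) ≡ true → ∃[ x ] (x ∈ˢ p × f x ≡ y)
      witness eq with Fin.any? (λ s → (s ∈? p) ×-dec (f s Fin.≟ y))
      ... | yes found = found
      witness () | no _

    image-mono : (f : Fin n → Fin n) {p q : Subset n} → p ⊆ q → image f p ⊆ image f q
    image-mono f {p} p⊆q y∈ with ∈image⁻ f p y∈
    ... | x , x∈p , refl = ∈image⁺ f (p⊆q x∈p)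

    image-cancel : (f g : Fin n → Fin n) → (∀ x → f (g x) ≡ x) → ∀ p → image f (image g p) ≡ p
    image-cancel f g fg≡id p = ⊆-antisym to from
      where
      to : image f (image g p) ⊆ p
      to x∈ with ∈image⁻ f (image g p) x∈
      ... | y , y∈ , refl with ∈image⁻ g p y∈
      ...   | z , z∈p , refl = subst (_∈ˢ p) (sym (fg≡id z)) z∈p
      from : p ⊆ image f (image g p)
      from {x} x∈p = subst (_∈ˢ image f (image g p)) (fg≡id x) (∈image⁺ f (∈image⁺ g x∈p))

    image-∪⁅⁆ : (f : Fin n → Fin n) (p : Subset n) (x : Fin n) → image f (p ∪ ⁅ x ⁆) ≡ image f p ∪ ⁅ f x ⁆
    image-∪⁅⁆ f p x = ⊆-antisym to from
      where
      to : image f (p ∪ ⁅ x ⁆) ⊆ image f p ∪ ⁅ f x ⁆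
      to y∈ with ∈image⁻ f (p ∪ ⁅ x ⁆) y∈
      ... | z , z∈ , refl with x∈p∪q⁻ p ⁅ x ⁆ z∈
      ...   | inj₁ z∈p = x∈p∪q⁺ (inj₁ (∈image⁺ f z∈p))
      ...   | inj₂ z∈x = x∈p∪q⁺ (inj₂ (subst (λ w → f z ∈ˢ ⁅ f w ⁆) (x∈⁅y⁆⇒x≡y x z∈x) (x∈⁅x⁆ (f z))))
      from : image f p ∪ ⁅ f x ⁆ ⊆ image f (p ∪ ⁅ x ⁆)
      from y∈ with x∈p∪q⁻ (image f p) ⁅ f x ⁆ y∈
      ... | inj₁ y∈fp = image-mono f (p⊆p∪q ⁅ x ⁆) y∈fp
      ... | inj₂ y∈fx = subst (_∈ˢ image f (p ∪ ⁅ x ⁆)) (sym (x∈⁅y⁆⇒x≡y (f x) y∈fx)) (∈image⁺ f (q⊆p∪q p ⁅ x ⁆ (x∈⁅x⁆ x)))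

    image-⊥ : (f : Fin n → Fin n) → image f ⊥ ≡ ⊥
    image-⊥ f = ⊆-antisym (λ y∈ → let _ , x∈⊥ , _ = ∈image⁻ f ⊥ y∈ in contradiction x∈⊥ ∉⊥) (⊆-min _)

    image-pair : (f : Fin n → Fin n) (a b : Fin n) → image f (pair a b) ≡ pair (f a) (f b)
    image-pair f a b = trans (image-∪⁅⁆ f ⁅ a ⁆ b) (cong (_∪ ⁅ f b ⁆) (trans (cong (image f) (sym (∪-identityˡ ⁅ a ⁆)))
      (trans (image-∪⁅⁆ f ⊥ a) (trans (cong (_∪ ⁅ f a ⁆) (image-⊥ f)) (∪-identityˡ ⁅ f a ⁆)))))

    ∣image∣ : (f : Fin n → Fin n) → (∀ {x y} → f x ≡ f y → x ≡ y) → ∀ p → ∣ image f p ∣ ≡ ∣ p ∣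
    ∣image∣ f f-inj p = go p refl
      where
      go : ∀ {k} p → ∣ p ∣ ≡ k → ∣ image f p ∣ ≡ k
      go {zero}  p ∣p∣≡0 = trans (cong (∣_∣ ∘ image f) (∣∣≡0⇒≡⊥ ∣p∣≡0)) (trans (cong ∣_∣ (image-⊥ f)) (∣⊥∣≡0 n))
      go {suc k} p ∣p∣≡  with split-suc p ∣p∣≡
      ... | q , x , x∉q , refl , ∣q∣≡k = trans (cong ∣_∣ (image-∪⁅⁆ f q x))
        (trans (∣p∪⁅x⁆∣ (image f q) (f x) fx∉) (cong suc (go q ∣q∣≡k)))
        where
        fx∉ : f x ∉ˢ image f q
        fx∉ fx∈ with ∈image⁻ f q fx∈
        ... | y , y∈q , fy≡fx = x∉q (subst (_∈ˢ q) (f-inj fy≡fx) y∈q)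

open Subsets

-- Neighbourhoods in the walk graph of a 2-complex

module Walk {n : ℕ} (X : SetFamily n) where
  open ≡ using (refl; cong; cong₂; sym; trans; subst)
  open Faces X
  open SetFamily X
  open Graph G-walk public using (_∼_; neighbours)

  ∈edges⁺ : ∀ {τ} → Edge τ → τ ∈ edges
  ∈edges⁺ {τ} = ∈-filter⁺ edge? (allSubsets-complete τ)

  ∈edges⁻ : ∀ {τ} → τ ∈ edges → Edge τ
  ∈edges⁻ τ∈ = proj₂ (∈-filter⁻ edge? {xs = allSubsets n} τ∈)

  edges-unique : Unique edges
  edges-unique = Unique.filter⁺ edge? (allSubsets-unique n)

  ∼-sym : ∀ {τ τ′} → τ ∼ τ′ → τ′ ∼ τ
  ∼-sym (τ≢τ′ , σ , △σ , τ⊆σ , τ′⊆σ) = τ≢τ′ ∘ sym , σ , △σ , τ′⊆σ , τ⊆σ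

  ∈neighbours⁺ : ∀ {τ τ′} → ∣ τ′ ∣ ≡ 2 → τ ∼ τ′ → τ′ ∈ neighbours τ
  ∈neighbours⁺ {τ} ∣τ′∣≡2 τ∼τ′@(_ , σ , △σ , _ , τ′⊆σ) = ∈-filter⁺ (Graph._∼?_ G-walk τ) (∈edges⁺ (∣τ′∣≡2 , σ , △σ , τ′⊆σ)) τ∼τ′

  ∈neighbours⁻ : ∀ {τ τ′} → τ′ ∈ neighbours τ → Edge τ′ × τ ∼ τ′
  ∈neighbours⁻ {τ} τ′∈ = let τ′∈edges , τ∼τ′ = ∈-filter⁻ (Graph._∼?_ G-walk τ) {xs = edges} τ′∈ in ∈edges⁻ τ′∈edges , τ∼τ′

  neighbours-unique : ∀ τ → Unique (neighbours τ)
  neighbours-unique τ = Unique.filter⁺ (Graph._∼?_ G-walk τ) edges-unique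

  edge-pair : ∀ {τ} → Edge τ → ∃[ a ] ∃[ b ] τ ≡ pair a b
  edge-pair {τ} (∣τ∣≡2 , _) = ∣∣≡2⇒pair τ ∣τ∣≡2

  edge⇒≢ : ∀ {a b} → Edge (pair a b) → a ≢ b
  edge⇒≢ = ∣pair∣≡2⇒≢ ∘ proj₁

  -- A common index set: the triangles on an edge and its walk neighbours are both described by the
  -- vertices that complete the edge, which links the degree to the regularity constant.
  thirds : Fin n → Fin n → List (Fin n)
  thirds a b = filter (λ c → ¬? (c ∈? pair a b) ×-dec face? (pair a b ∪ ⁅ c ⁆)) (allFin n)

  private
    third? : ∀ a b c → Dec (c ∉ˢ pair a b × Face (pair a b ∪ ⁅ c ⁆))
    third? a b c = ¬? (c ∈? pair a b) ×-dec face? (pair a b ∪ ⁅ c ⁆)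

  ∈thirds⁺ : ∀ {a b c} → c ∉ˢ pair a b → Face (pair a b ∪ ⁅ c ⁆) → c ∈ thirds a b
  ∈thirds⁺ {a} {b} {c} c∉ face = ∈-filter⁺ (third? a b) (∈-allFin c) (c∉ , face)

  ∈thirds⁻ : ∀ {a b c} → c ∈ thirds a b → c ∉ˢ pair a b × Face (pair a b ∪ ⁅ c ⁆)
  ∈thirds⁻ {a} {b} c∈ = proj₂ (∈-filter⁻ (third? a b) {xs = allFin n} c∈)

  thirds-unique : ∀ a b → Unique (thirds a b)
  thirds-unique a b = Unique.filter⁺ (third? a b) (Unique.allFin⁺ n)

  triangle-third : ∀ {a b σ} → ∣ pair a b ∣ ≡ 2 → Triangle σ → pair a b ⊆ σ → ∃[ c ] (c ∈ thirds a b × σ ≡ pair a b ∪ ⁅ c ⁆)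
  triangle-third ∣ab∣≡2 (face , ∣σ∣≡3) ab⊆σ with ⊆∧∣∣≡suc⇒∪⁅⁆ ab⊆σ (trans ∣σ∣≡3 (cong suc (sym ∣ab∣≡2)))
  ... | c , c∉ , refl = c , ∈thirds⁺ c∉ face , refl

  third-triangle : ∀ {a b c} → ∣ pair a b ∣ ≡ 2 → c ∈ thirds a b → Triangle (pair a b ∪ ⁅ c ⁆)
  third-triangle {a} {b} {c} ∣ab∣≡2 c∈ = let c∉ , face = ∈thirds⁻ c∈ in face , trans (∣p∪⁅x⁆∣ (pair a b) c c∉) (cong suc ∣ab∣≡2)

  trianglesOn-pair : ∀ {a b} → ∣ pair a b ∣ ≡ 2 → trianglesOn (pair a b) ↭ map (λ c → pair a b ∪ ⁅ c ⁆) (thirds a b)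
  trianglesOn-pair {a} {b} ∣ab∣≡2 = unique∧set⇒↭
    (Unique.filter⁺ P? (allSubsets-unique n))
    (map-unique injective (thirds-unique a b))
    (λ σ∈ → let _ , △σ , ab⊆σ = ∈-filter⁻ P? {xs = allSubsets n} σ∈ ; c , c∈ , σ≡ = triangle-third ∣ab∣≡2 △σ ab⊆σ in
            subst (_∈ _) (sym σ≡) (∈-map⁺ _ c∈))
    (λ σ∈ → let c , c∈ , σ≡ = ∈-map⁻ _ σ∈ in
            subst (_∈ trianglesOn (pair a b)) (sym σ≡)
              (∈-filter⁺ P? (allSubsets-complete _) (third-triangle ∣ab∣≡2 c∈ , p⊆p∪q ⁅ c ⁆)))
    where
    P? = λ σ → triangle? σ ×-dec (pair a b ⊆? σ)
    injective : ∀ {c d} → c ∈ thirds a b → d ∈ thirds a b → pair a b ∪ ⁅ c ⁆ ≡ pair a b ∪ ⁅ d ⁆ → c ≡ d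
    injective {c} {d} c∈ _ eq with x∈p∪q⁻ (pair a b) ⁅ d ⁆ (subst (c ∈ˢ_) eq (q⊆p∪q (pair a b) ⁅ c ⁆ (x∈⁅x⁆ c)))
    ... | inj₁ c∈ab = contradiction c∈ab (proj₁ (∈thirds⁻ c∈))
    ... | inj₂ c∈d  = x∈⁅y⁆⇒x≡y d c∈d

  ∼pair⁻ : ∀ {a b τ} → ∣ pair a b ∣ ≡ 2 → ∣ τ ∣ ≡ 2 → pair a b ∼ τ →
           ∃[ c ] (c ∈ thirds a b × (τ ≡ pair a c ⊎ τ ≡ pair b c))
  ∼pair⁻ ∣ab∣≡2 ∣τ∣≡2 (ab≢τ , σ , △σ , ab⊆σ , τ⊆σ) =
    let c , c∈ , σ≡ = triangle-third ∣ab∣≡2 △σ ab⊆σ in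
    c , c∈ , pair-in-triple ∣ab∣≡2 ∣τ∣≡2 (λ x∈ → subst (_ ∈ˢ_) σ≡ (τ⊆σ x∈)) ab≢τ

  -- Each completing vertex `c` contributes the two other sides of its triangle. The two lists do
  -- not meet, because `a` differs from `b` and from every completing vertex.
  neighbours-pair : ∀ {a b} → ∣ pair a b ∣ ≡ 2 → neighbours (pair a b) ↭ map (pair a) (thirds a b) ++ map (pair b) (thirds a b)
  neighbours-pair {a} {b} ∣ab∣≡2 = unique∧set⇒↭
    (neighbours-unique (pair a b))
    (Unique.++⁺ (map-unique (injective (a∈pair a b)) (thirds-unique a b)) (map-unique (injective (b∈pair a b)) (thirds-unique a b)) disjoint)
    to
    (λ τ∈ → [ from (a∈pair a b) , from (b∈pair a b) ]′ (∈-++⁻ (map (pair a) (thirds a b)) τ∈))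
    where
    third≢ : ∀ {x c} → x ∈ˢ pair a b → c ∈ thirds a b → x ≢ c
    third≢ x∈ c∈ refl = proj₁ (∈thirds⁻ c∈) x∈

    injective : ∀ {x c d} → x ∈ˢ pair a b → c ∈ thirds a b → d ∈ thirds a b → pair x c ≡ pair x d → c ≡ d
    injective {x} {c} {d} x∈ c∈ _ eq with ∈pair⁻ (subst (c ∈ˢ_) eq (b∈pair x c))
    ... | inj₁ c≡x = contradiction (sym c≡x) (third≢ x∈ c∈)
    ... | inj₂ c≡d = c≡d

    disjoint : ∀ {τ} → ¬ (τ ∈ map (pair a) (thirds a b) × τ ∈ map (pair b) (thirds a b))
    disjoint (τ∈ , τ∈′) with ∈-map⁻ _ τ∈ | ∈-map⁻ _ τ∈′
    ... | c , _ , refl | d , d∈ , eq with ∈pair⁻ (subst (a ∈ˢ_) eq (a∈pair a c))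
    ...   | inj₁ a≡b = ∣pair∣≡2⇒≢ ∣ab∣≡2 a≡b
    ...   | inj₂ a≡d = third≢ (a∈pair a b) d∈ a≡d

    to : ∀ {τ} → τ ∈ neighbours (pair a b) → τ ∈ map (pair a) (thirds a b) ++ map (pair b) (thirds a b)
    to τ∈ with ∈neighbours⁻ τ∈
    ... | (∣τ∣≡2 , _) , ab∼τ with ∼pair⁻ ∣ab∣≡2 ∣τ∣≡2 ab∼τ
    ...   | c , c∈ , inj₁ refl = ∈-++⁺ˡ (∈-map⁺ (pair a) c∈)
    ...   | c , c∈ , inj₂ refl = ∈-++⁺ʳ (map (pair a) (thirds a b)) (∈-map⁺ (pair b) c∈)

    from : ∀ {x τ} → x ∈ˢ pair a b → τ ∈ map (pair x) (thirds a b) → τ ∈ neighbours (pair a b)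
    from {x} x∈ τ∈ with ∈-map⁻ _ τ∈
    ... | c , c∈ , refl = ∈neighbours⁺ (∣pair∣ (third≢ x∈ c∈))
      ((λ ab≡xc → proj₁ (∈thirds⁻ c∈) (subst (c ∈ˢ_) (sym ab≡xc) (b∈pair x c)))
      , pair a b ∪ ⁅ c ⁆ , third-triangle ∣ab∣≡2 c∈ , p⊆p∪q ⁅ c ⁆
      , pair-⊆ (p⊆p∪q ⁅ c ⁆ x∈) (q⊆p∪q (pair a b) ⁅ c ⁆ (x∈⁅x⁆ c)))

  length-neighbours : ∀ {d} → Regular d → ∀ {τ} → Edge τ → length (neighbours τ) ≡ d ℕ.+ d
  length-neighbours {d} regular {τ} edge with edge-pair edge
  ... | a , b , refl = trans (↭-length (neighbours-pair (proj₁ edge))) (trans (length-++ (map (pair a) (thirds a b)))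
      (cong₂ ℕ._+_ (trans (length-map _ (thirds a b)) ∣thirds∣) (trans (length-map _ (thirds a b)) ∣thirds∣)))
    where
    ∣thirds∣ : length (thirds a b) ≡ d
    ∣thirds∣ = trans (sym (length-map _ (thirds a b))) (trans (sym (↭-length (trianglesOn-pair (proj₁ edge)))) (regular (pair a b) edge))

  -- The triangle that witnesses the edge is counted by `d`. This keeps the later inverses of
  -- degrees away from zero, where `_⁻¹` is unspecified.
  regular⇒nonZero : ∀ {d} → Regular d → ∀ {τ} → Edge τ → d ≢ 0
  regular⇒nonZero regular {τ} edge@(_ , σ , △σ , τ⊆σ) refl = contradiction
    (subst (0 ℕ.<_) (regular τ edge) (∈⇒0<length (∈-filter⁺ (λ σ → triangle? σ ×-dec (τ ⊆? σ)) (allSubsets-complete σ) (△σ , τ⊆σ))))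
    λ ()
    where
    ∈⇒0<length : ∀ {A : Set} {x : A} {xs} → x ∈ xs → 0 ℕ.< length xs
    ∈⇒0<length (here _)  = ℕ.s≤s ℕ.z≤n
    ∈⇒0<length (there _) = ℕ.s≤s ℕ.z≤n

-- The walk on Sc and the replacement product

module Triplets (G : FiniteGroup) (S : SetFamily (FiniteGroup.order G)) (complex : Is2DimComplex S)
                (cts : CTS.IsCommutativeTripletStructure G S) where
  open ≡ using (refl; cong; cong₂; sym; trans; subst)
  open FiniteGroup G
  open CTS G S
  open IsCommutativeTripletStructure cts
  open Is2DimComplex complex

  private
    group : Group _ _
    group = record { isGroup = isGroup }
    module SS = Faces S
    module SC = Faces Sc
    module WS = Walk S
    module WC = Walk Sc

  open Group group using (assoc; identityˡ; identityʳ; inverseˡ; inverseʳ)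
  open Algebra.Properties.Group group
    using (∙-cancelˡ; ∙-cancelʳ; ⁻¹-involutive; ⁻¹-anti-homo-∙; inverseʳ-unique; identityˡ-unique)

  Vertices : Set
  Vertices = Fin order × Subset order

  act : Vertices → Subset order
  act (g , τ) = τ · g

  blue : Vertices → Vertices
  blue (g , τ) = hat τ g , inv τ

  ∙⁻¹-cancel : ∀ x g → x ∙ g ∙ g ⁻¹ ≡ x
  ∙⁻¹-cancel x g = trans (assoc x g _) (trans (cong (x ∙_) (inverseʳ g)) (identityʳ x))

  ⁻¹∙-cancel : ∀ x g → x ∙ g ⁻¹ ∙ g ≡ x
  ⁻¹∙-cancel x g = trans (assoc x _ g) (trans (cong (x ∙_) (inverseˡ g)) (identityʳ x))

  cancel-⁻¹∙ : ∀ x g → x ⁻¹ ∙ (x ∙ g) ≡ g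
  cancel-⁻¹∙ x g = trans (sym (assoc _ x g)) (trans (cong (_∙ g) (inverseˡ x)) (identityˡ g))

  ·-⁻¹ʳ : ∀ σ g → (σ · g) · (g ⁻¹) ≡ σ
  ·-⁻¹ʳ σ g = image-cancel (_∙ g ⁻¹) (_∙ g) (λ x → ∙⁻¹-cancel x g) σ

  ·-⁻¹ˡ : ∀ σ g → (σ · (g ⁻¹)) · g ≡ σ
  ·-⁻¹ˡ σ g = image-cancel (_∙ g) (_∙ g ⁻¹) (λ x → ⁻¹∙-cancel x g) σ

  ∣·∣ : ∀ σ g → ∣ σ · g ∣ ≡ ∣ σ ∣
  ∣·∣ σ g = ∣image∣ (_∙ g) (∙-cancelʳ g _ _) σ

  ·-injective : ∀ {σ τ g} → σ · g ≡ τ · g → σ ≡ τ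
  ·-injective {σ} {τ} {g} eq = trans (sym (·-⁻¹ʳ σ g)) (trans (cong (_· (g ⁻¹)) eq) (·-⁻¹ʳ τ g))

  triangle⁺ : ∀ {σ} g → SS.Triangle σ → SC.Triangle (σ · g)
  triangle⁺ {σ} g (face , ∣σ∣≡3) = (σ , face , g , refl) , trans (∣·∣ σ g) ∣σ∣≡3

  triangle⁻ : ∀ {ρ} → SC.Triangle ρ → ∃[ σ ] ∃[ g ] (SS.Triangle σ × ρ ≡ σ · g)
  triangle⁻ ((σ , face , g , refl) , ∣ρ∣≡3) = σ , g , (face , trans (sym (∣·∣ σ g)) ∣ρ∣≡3) , refl

  edge⁺ : ∀ {τ} g → SS.Edge τ → SC.Edge (τ · g)
  edge⁺ {τ} g (∣τ∣≡2 , σ , △σ , τ⊆σ) = trans (∣·∣ τ g) ∣τ∣≡2 , σ · g , triangle⁺ g △σ , image-mono (_∙ g) τ⊆σ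

  shift-⊆ : ∀ {e σ g} → e ⊆ σ · g → e · (g ⁻¹) ⊆ σ
  shift-⊆ {e} {σ} {g} e⊆ x∈ = subst (_ ∈ˢ_) (·-⁻¹ʳ σ g) (image-mono (_∙ g ⁻¹) e⊆ x∈)

  edge⁻ : ∀ {e} → SC.Edge e → ∃[ g ] ∃[ τ ] (SS.Edge τ × e ≡ τ · g)
  edge⁻ {e} (∣e∣≡2 , ρ , △ρ , e⊆ρ) with triangle⁻ △ρ
  ... | σ , g , △σ , refl = g , e · (g ⁻¹) , (trans (∣·∣ e _) ∣e∣≡2 , σ , △σ , shift-⊆ e⊆ρ) , sym (·-⁻¹ˡ e g)

  ∙-swap : ∀ {a b} → SS.Edge (pair a b) → ∀ g → a ∙ (b ∙ g) ≡ b ∙ (a ∙ g)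
  ∙-swap {a} {b} edge g = trans (sym (assoc a b g)) (trans (cong (_∙ g) (cond-B a b edge)) (assoc b a g))

  hat-pair : ∀ {a b} → SS.Edge (pair a b) → ∀ g → hat (pair a b) g ≡ a ∙ (b ∙ g)
  hat-pair {a} {b} edge g with unique-two (Unique.filter⁺ (_∈? pair a b) (Unique.allFin⁺ order))
      (λ x∈ → ∈pair⁻ (proj₂ (∈-filter⁻ (_∈? pair a b) {xs = allFin order} x∈)))
      (∈-filter⁺ (_∈? pair a b) (∈-allFin a) (a∈pair a b))
      (∈-filter⁺ (_∈? pair a b) (∈-allFin b) (b∈pair a b))
      (WS.edge⇒≢ edge)
  ... | inj₁ eq = cong (foldr _∙_ g) eq
  ... | inj₂ eq = trans (cong (foldr _∙_ g) eq) (sym (∙-swap edge g))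

  inv-edge : ∀ {τ} → SS.Edge τ → SS.Edge (inv τ)
  inv-edge edge with WS.edge-pair edge
  ... | a , b , refl = subst SS.Edge (sym (image-pair _⁻¹ a b)) (Equivalence.to (cond-C a b) edge)

  inv-involutive : ∀ τ → inv (inv τ) ≡ τ
  inv-involutive = image-cancel _⁻¹ _⁻¹ ⁻¹-involutive

  blue-blue : ∀ g {τ} → SS.Edge τ → blue (blue (g , τ)) ≡ (g , τ)
  blue-blue g {τ} edge = cong₂ _,_ (hat-hat edge) (inv-involutive τ)
    where
    hat-hat : ∀ {τ} → SS.Edge τ → hat (inv τ) (hat τ g) ≡ g
    hat-hat edge with WS.edge-pair edge
    ... | a , b , refl = trans (cong₂ hat (image-pair _⁻¹ a b) (hat-pair edge g))
      (trans (hat-pair (Equivalence.to (cond-C a b) edge) _)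
        (trans (cong (λ x → a ⁻¹ ∙ (b ⁻¹ ∙ x)) (∙-swap edge g))
          (trans (cong (a ⁻¹ ∙_) (cancel-⁻¹∙ b _)) (cancel-⁻¹∙ a g))))

  -- For τ = {a, b}, translation by `abg` sends `a⁻¹` to `bg` and, by `cond-B`, `b⁻¹` to `ag`. The
  -- partner presents the same edge with the roles of its two ends exchanged.
  act-blue : ∀ g {τ} → SS.Edge τ → act (blue (g , τ)) ≡ τ · g
  act-blue g edge with WS.edge-pair edge
  ... | a , b , refl = trans (cong₂ _·_ (image-pair _⁻¹ a b) (hat-pair edge g))
    (trans (image-pair (_∙ (a ∙ (b ∙ g))) _ _)
      (trans (cong₂ pair (cancel-⁻¹∙ a _) (trans (cong (b ⁻¹ ∙_) (∙-swap edge g)) (cancel-⁻¹∙ b _)))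
        (trans (pair-comm _ _) (sym (image-pair (_∙ g) a b)))))

  -- A fixed point would force `a ∙ b` to be the identity, so that the edge would be a vertex
  -- together with its inverse, against `cond-0`.
  hat≢ : ∀ g {τ} → SS.Edge τ → hat τ g ≢ g
  hat≢ g edge hat≡g with WS.edge-pair edge
  ... | a , b , refl = cond-0 a vertex (subst (λ x → SS.Edge (pair a x)) b≡a⁻¹ edge)
    where
    b≡a⁻¹ : b ≡ a ⁻¹
    b≡a⁻¹ = inverseʳ-unique a b (identityˡ-unique (a ∙ b) g (trans (assoc a b g) (trans (sym (hat-pair edge g)) hat≡g)))
    vertex : SS.Vertex a
    vertex = let _ , σ , (face , _) , ab⊆σ = edge in
      down-closed face (λ x∈ → subst (_∈ˢ σ) (sym (x∈⁅y⁆⇒x≡y a x∈)) (ab⊆σ (a∈pair a b))) (a , x∈⁅x⁆ a)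

  -- Translation leaves the quotient of two elements unchanged: `ag` times the inverse of `bg` is
  -- `a ∙ b ⁻¹`. Matching ends through the common edge therefore gives two ordered pairs with equal
  -- quotients, to which `cond-D` applies. The translating element is then recovered from one end.
  presentations : ∀ {g h τ τ′} → SS.Edge τ → SS.Edge τ′ → τ · g ≡ τ′ · h → (h , τ′) ≡ (g , τ) ⊎ (h , τ′) ≡ blue (g , τ)
  presentations {g} {h} {τ} {τ′} edge edge′ eq with WS.edge-pair edge
  ... | a , b , refl = result (lift (a∈pair a b)) (lift (b∈pair a b))
    where
    lift : ∀ {x} → x ∈ˢ pair a b → ∃[ y ] (y ∈ˢ τ′ × y ∙ h ≡ x ∙ g)
    lift x∈ = ∈image⁻ (_∙ h) τ′ (subst (_ ∈ˢ_) eq (∈image⁺ (_∙ g) x∈))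

    quotient : ∀ {x y} z → x ∙ z ∙ (y ∙ z) ⁻¹ ≡ x ∙ y ⁻¹
    quotient {x} {y} z = trans (cong (x ∙ z ∙_) (⁻¹-anti-homo-∙ y z))
      (trans (sym (assoc _ _ _)) (cong (_∙ y ⁻¹) (∙⁻¹-cancel x z)))

    result : ∃[ y ] (y ∈ˢ τ′ × y ∙ h ≡ a ∙ g) → ∃[ y ] (y ∈ˢ τ′ × y ∙ h ≡ b ∙ g) →
             (h , τ′) ≡ (g , pair a b) ⊎ (h , τ′) ≡ blue (g , pair a b)
    result (a′ , a′∈ , a′h≡ag) (b′ , b′∈ , b′h≡bg) = cases (≡-dec Fin._≟_ Fin._≟_ (a , b) (a′ , b′))
      where
      a′≢b′ : a′ ≢ b′
      a′≢b′ refl = WS.edge⇒≢ edge (∙-cancelʳ g a b (trans (sym a′h≡ag) b′h≡bg))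

      τ′≡pair : pair a′ b′ ≡ τ′
      τ′≡pair = ⊆∧∣∣≡⇒≡ (pair-⊆ a′∈ b′∈) (trans (∣pair∣ a′≢b′) (sym (proj₁ edge′)))

      cases : Dec ((a , b) ≡ (a′ , b′)) → _
      cases (yes refl) = inj₁ (cong₂ _,_ (∙-cancelˡ a h g a′h≡ag) (sym τ′≡pair))
      cases (no ab≢a′b′) =
        let b′≡a⁻¹ , a′≡b⁻¹ = cond-D a b a′ b′ edge (subst SS.Edge (sym τ′≡pair) edge′) ab≢a′b′
              (trans (sym (quotient g)) (trans (cong₂ (λ x y → x ∙ y ⁻¹) (sym a′h≡ag) (sym b′h≡bg)) (quotient h)))
        in inj₂ (cong₂ _,_
          (trans (sym (cancel-⁻¹∙ b′ h)) (trans (cong₂ _∙_ (trans (cong _⁻¹ b′≡a⁻¹) (⁻¹-involutive a)) b′h≡bg) (sym (hat-pair edge g))))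
          (trans (sym τ′≡pair) (trans (cong₂ pair a′≡b⁻¹ b′≡a⁻¹) (trans (pair-comm _ _) (sym (image-pair _⁻¹ a b))))))

  ·-∼ : ∀ {τ τ′} g → τ WS.∼ τ′ → (τ · g) WC.∼ (τ′ · g)
  ·-∼ g (τ≢τ′ , σ , △σ , τ⊆σ , τ′⊆σ) = τ≢τ′ ∘ ·-injective , σ · g , triangle⁺ g △σ , image-mono (_∙ g) τ⊆σ , image-mono (_∙ g) τ′⊆σ

  -- Adjacent edges share one vertex, so equal products would, after cancelling it, identify the
  -- third vertex of the triangle with an end of τ. Needed to keep the two halves of a neighbourhood
  -- in `Sc` apart.
  hat-∼ : ∀ g {τ τ′} → SS.Edge τ → SS.Edge τ′ → τ WS.∼ τ′ → hat τ g ≢ hat τ′ g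
  hat-∼ g edge edge′ τ∼τ′ hat≡ with WS.edge-pair edge
  ... | a , b , refl with WS.∼pair⁻ (proj₁ edge) (proj₁ edge′) τ∼τ′
  ...   | c , c∈ , inj₁ refl = proj₁ (WS.∈thirds⁻ c∈) (subst (_∈ˢ pair a b) b≡c (b∈pair a b))
    where
    b≡c : b ≡ c
    b≡c = ∙-cancelʳ g b c (∙-cancelˡ a _ _ (trans (sym (hat-pair edge g)) (trans hat≡ (hat-pair edge′ g))))
  ...   | c , c∈ , inj₂ refl = proj₁ (WS.∈thirds⁻ c∈) (subst (_∈ˢ pair a b) a≡c (a∈pair a b))
    where
    a≡c : a ≡ c
    a≡c = ∙-cancelʳ g a c (∙-cancelˡ b _ _ (trans (sym (∙-swap edge g)) (trans (sym (hat-pair edge g)) (trans hat≡ (hat-pair edge′ g)))))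

  -- Any triangle on the edge is a translate `σ · h`, and translating back presents the edge inside
  -- `σ`. By `presentations` only two choices of `h` occur, one for each half. A neighbour in both
  -- halves would have two presentations itself, giving either a fixed point of `hat τ` or a clash
  -- with `hat-∼`.
  walk-neighbours : ∀ g {τ} → SS.Edge τ →
    WC.neighbours (τ · g) ↭ map (_· g) (WS.neighbours τ) ++ map (_· hat τ g) (WS.neighbours (inv τ))
  walk-neighbours g {τ} edge = unique∧set⇒↭
    (WC.neighbours-unique (τ · g))
    (Unique.++⁺ (Unique.map⁺ ·-injective (WS.neighbours-unique τ)) (Unique.map⁺ ·-injective (WS.neighbours-unique (inv τ))) disjoint)
    to
    (λ e∈ → [ from g τ , (λ e∈ → subst (λ e → _ ∈ WC.neighbours e) (act-blue g edge) (from (hat τ g) (inv τ) e∈)) ]′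
              (∈-++⁻ (map (_· g) (WS.neighbours τ)) e∈))
    where
    disjoint : ∀ {e} → ¬ (e ∈ map (_· g) (WS.neighbours τ) × e ∈ map (_· hat τ g) (WS.neighbours (inv τ)))
    disjoint (e∈ , e∈′) with ∈-map⁻ _ e∈ | ∈-map⁻ _ e∈′
    ... | τ′ , τ′∈ , refl | τ″ , τ″∈ , eq with WS.∈neighbours⁻ τ′∈ | WS.∈neighbours⁻ τ″∈
    ...   | edge′ , τ∼τ′ | edge″ , _ with presentations edge′ edge″ eq
    ...     | inj₁ same = hat≢ g edge (cong proj₁ same)
    ...     | inj₂ other = hat-∼ g edge edge′ τ∼τ′ (cong proj₁ other)

    from : ∀ h ρ {e} → e ∈ map (_· h) (WS.neighbours ρ) → e ∈ WC.neighbours (ρ · h)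
    from h ρ e∈ with ∈-map⁻ _ e∈
    ... | τ′ , τ′∈ , refl = let edge′ , ρ∼τ′ = WS.∈neighbours⁻ τ′∈ in
      WC.∈neighbours⁺ (trans (∣·∣ τ′ h) (proj₁ edge′)) (·-∼ h ρ∼τ′)

    to : ∀ {e} → e ∈ WC.neighbours (τ · g) → e ∈ map (_· g) (WS.neighbours τ) ++ map (_· hat τ g) (WS.neighbours (inv τ))
    to {e} e∈ with WC.∈neighbours⁻ e∈
    ... | (∣e∣≡2 , _) , (τg≢e , ρ , △ρ , τg⊆ρ , e⊆ρ) with triangle⁻ △ρ
    ...   | σ , h , △σ , refl = place (presentations edge edge₀ (sym (·-⁻¹ˡ (τ · g) h)))
      where
      τ₀ = (τ · g) · (h ⁻¹)
      τ′ = e · (h ⁻¹)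
      edge₀ : SS.Edge τ₀
      edge₀ = trans (∣·∣ (τ · g) _) (trans (∣·∣ τ g) (proj₁ edge)) , σ , △σ , shift-⊆ τg⊆ρ
      τ′∈ : τ′ ∈ WS.neighbours τ₀
      τ′∈ = WS.∈neighbours⁺ (trans (∣·∣ e _) ∣e∣≡2) (τg≢e ∘ ·-injective , σ , △σ , shift-⊆ τg⊆ρ , shift-⊆ e⊆ρ)
      e∈′ : e ∈ map (_· h) (WS.neighbours τ₀)
      e∈′ = subst (_∈ map (_· h) (WS.neighbours τ₀)) (·-⁻¹ˡ e h) (∈-map⁺ (_· h) τ′∈)
      place : (h , τ₀) ≡ (g , τ) ⊎ (h , τ₀) ≡ blue (g , τ) → e ∈ map (_· g) (WS.neighbours τ) ++ map (_· hat τ g) (WS.neighbours (inv τ))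
      place (inj₁ eq) = ∈-++⁺ˡ (subst (λ { (h , τ₀) → e ∈ map (_· h) (WS.neighbours τ₀) }) eq e∈′)
      place (inj₂ eq) = ∈-++⁺ʳ (map (_· g) (WS.neighbours τ)) (subst (λ { (h , τ₀) → e ∈ map (_· h) (WS.neighbours τ₀) }) eq e∈′)

  ∈product⁺ : ∀ g {τ} → SS.Edge τ → (g , τ) ∈ product-vertices
  ∈product⁺ g edge = ∈-cartesianProduct⁺ (∈-allFin g) (WS.∈edges⁺ edge)

  ∈product⁻ : ∀ {g τ} → (g , τ) ∈ product-vertices → SS.Edge τ
  ∈product⁻ p∈ = WS.∈edges⁻ (proj₂ (∈-cartesianProduct⁻ (allFin order) SS.edges p∈))

  product-unique : Unique product-vertices
  product-unique = Unique.cartesianProduct⁺ (Unique.allFin⁺ order) WS.edges-unique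

  blue∈ : ∀ {p} → p ∈ product-vertices → blue p ∈ product-vertices
  blue∈ p∈ = ∈product⁺ _ (inv-edge (∈product⁻ p∈))

  presentation : Subset order → Vertices
  presentation e with Fin.any? (λ g → anySubset? (λ τ → SS.edge? τ ×-dec (e ≟ˢ (τ · g))))
  ... | yes (g , τ , _) = g , τ
  -- A default for sets that are not edges of `Sc`; on edges `presentation-correct` rules this
  -- branch out.
  ... | no  _           = ε , e

  presentation-correct : ∀ {e} → e ∈ SC.edges → presentation e ∈ product-vertices × act (presentation e) ≡ e
  presentation-correct {e} e∈ with Fin.any? (λ g → anySubset? (λ τ → SS.edge? τ ×-dec (e ≟ˢ (τ · g))))
  ... | yes (g , τ , edge , e≡) = ∈product⁺ g edge , sym e≡
  ... | no  none                = contradiction (edge⁻ (WC.∈edges⁻ e∈)) none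

  -- The chosen presentations are one half of the blue matching and their partners the other.
  -- Overlap of the halves would, after applying `act`, make some presentation its own partner.
  product-presentations : product-vertices ↭ map presentation SC.edges ++ map (blue ∘ presentation) SC.edges
  product-presentations = unique∧set⇒↭ product-unique
    (Unique.++⁺ (map-unique injective WC.edges-unique) (map-unique (λ e∈ e′∈ eq → injective e∈ e′∈ (blue-injective e∈ e′∈ eq)) WC.edges-unique) disjoint)
    to
    (λ p∈ → [ (λ p∈ → let e , e∈ , p≡ = ∈-map⁻ _ p∈ in subst (_∈ product-vertices) (sym p≡) (proj₁ (presentation-correct e∈)))
            , (λ p∈ → let e , e∈ , p≡ = ∈-map⁻ _ p∈ in subst (_∈ product-vertices) (sym p≡) (blue∈ (proj₁ (presentation-correct e∈)))) ]′
            (∈-++⁻ (map presentation SC.edges) p∈))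
    where
    injective : ∀ {e e′} → e ∈ SC.edges → e′ ∈ SC.edges → presentation e ≡ presentation e′ → e ≡ e′
    injective e∈ e′∈ eq = trans (sym (proj₂ (presentation-correct e∈))) (trans (cong act eq) (proj₂ (presentation-correct e′∈)))

    blue-injective : ∀ {e e′} → e ∈ SC.edges → e′ ∈ SC.edges → blue (presentation e) ≡ blue (presentation e′) → presentation e ≡ presentation e′
    blue-injective e∈ e′∈ eq =
      trans (sym (blue-blue _ (∈product⁻ (proj₁ (presentation-correct e∈)))))
        (trans (cong blue eq) (blue-blue _ (∈product⁻ (proj₁ (presentation-correct e′∈)))))

    disjoint : ∀ {p} → ¬ (p ∈ map presentation SC.edges × p ∈ map (blue ∘ presentation) SC.edges)
    disjoint (p∈ , p∈′) with ∈-map⁻ _ p∈ | ∈-map⁻ _ p∈′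
    ... | e , e∈ , refl | e′ , e′∈ , eq = hat≢ _ edge′ (sym (cong proj₁ (subst (λ e → presentation e ≡ blue (presentation e′)) e≡e′ eq)))
      where
      edge′ = ∈product⁻ (proj₁ (presentation-correct e′∈))
      e≡e′ : e ≡ e′
      e≡e′ = trans (sym (proj₂ (presentation-correct e∈))) (trans (cong act eq)
        (trans (act-blue _ edge′) (proj₂ (presentation-correct e′∈))))

    to : ∀ {p} → p ∈ product-vertices → p ∈ map presentation SC.edges ++ map (blue ∘ presentation) SC.edges
    to {g , τ} p∈ = [ (λ eq → ∈-++⁺ˡ (subst (_∈ _) (sym eq) (∈-map⁺ presentation e∈)))
                    , (λ eq → ∈-++⁺ʳ (map presentation SC.edges) (subst (_∈ _) (sym eq) (∈-map⁺ (blue ∘ presentation) e∈))) ]′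
                    (presentations (∈product⁻ (proj₁ correct)) edge (proj₂ correct))
      where
      edge = ∈product⁻ p∈
      e∈ : τ · g ∈ SC.edges
      e∈ = WC.∈edges⁺ (edge⁺ g edge)
      correct = presentation-correct e∈

  red-neighbours : ∀ g τ → Graph.neighbours Red (g , τ) ↭ map (g ,_) (WS.neighbours τ)
  red-neighbours g τ = unique∧set⇒↭
    (Unique.filter⁺ (Graph._∼?_ Red (g , τ)) product-unique)
    (Unique.map⁺ (cong proj₂) (WS.neighbours-unique τ))
    to from
    where
    to : ∀ {p} → p ∈ Graph.neighbours Red (g , τ) → p ∈ map (g ,_) (WS.neighbours τ)
    to p∈ with ∈-filter⁻ (Graph._∼?_ Red (g , τ)) {xs = product-vertices} p∈
    ... | p∈vs , refl , τ∼τ′ = ∈-map⁺ (g ,_) (WS.∈neighbours⁺ (proj₁ (∈product⁻ p∈vs)) τ∼τ′)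
    from : ∀ {p} → p ∈ map (g ,_) (WS.neighbours τ) → p ∈ Graph.neighbours Red (g , τ)
    from p∈ with ∈-map⁻ _ p∈
    ... | τ′ , τ′∈ , refl = let edge′ , τ∼τ′ = WS.∈neighbours⁻ τ′∈ in
      ∈-filter⁺ (Graph._∼?_ Red (g , τ)) (∈product⁺ g edge′) (refl , τ∼τ′)

  blue-neighbours : ∀ {p} → p ∈ product-vertices → Graph.neighbours Blue p ↭ blue p ∷ []
  blue-neighbours {p} p∈ = unique∧set⇒↭
    (Unique.filter⁺ (Graph._∼?_ Blue p) product-unique) ([] ∷ [])
    (λ q∈ → let _ , g≡ , τ≡ = ∈-filter⁻ (Graph._∼?_ Blue p) {xs = product-vertices} q∈ in here (cong₂ _,_ g≡ τ≡))
    (λ { (here refl) → ∈-filter⁺ (Graph._∼?_ Blue p) (blue∈ p∈) (refl , refl) })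

  red-sym : ∀ {p q} → Graph._∼_ Red p q → Graph._∼_ Red q p
  red-sym (g≡ , τ∼) = sym g≡ , WS.∼-sym τ∼

-- Lifting eigenfunctions of the walk to the replacement product

module Lift (ℝ : RealNumbers) (G : FiniteGroup) (S : SetFamily (FiniteGroup.order G)) (complex : Is2DimComplex S)
            (cts : CTS.IsCommutativeTripletStructure G S) where
  open CTS G S
  open IsCommutativeTripletStructure cts
  open Triplets G S complex cts
  open OrderedField ℝ
  open Sums ℝ
  open Spectrum ℝ
  open Spectral ℝ (≡-dec Fin._≟_ _≟ˢ_) product-vertices product-unique
  open SetoidReasoning setoid

  private
    module SS = Faces S
    module WS = Walk S
    module WC = Walk Sc

    d = proj₁ cond-A
    m = d ℕ.+ d
    κ = fromℕ m ⁻¹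

    P-R P-B : Operator Vertices
    P-R = normalizedAdjacency Red
    P-B = normalizedAdjacency Blue

  length-L : ∀ {τ} → SS.Edge τ → length (WS.neighbours τ) ≡ m
  length-L = WS.length-neighbours (proj₂ cond-A)

  length-red : ∀ {p} → p ∈ product-vertices → length (Graph.neighbours Red p) ≡ m
  length-red {g , τ} p∈ = ≡.trans (↭-length (red-neighbours g τ))
    (≡.trans (length-map _ (WS.neighbours τ)) (length-L (∈product⁻ p∈)))

  0<m : ∀ {τ} → SS.Edge τ → 0# < fromℕ m
  0<m edge with d in eq
  ... | zero  = contradiction eq (WS.regular⇒nonZero (proj₂ cond-A) edge)
  ... | suc k = 0<fromℕ (k ℕ.+ suc k)

  -- The kernel of `P-R`, with the constant weight `κ` in place of the inverse degree at `p`. It is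
  -- then symmetric on all of `Vertices`, while agreement with `P-R` is claimed on the vertex list,
  -- where every red degree is `m`.
  w : Vertices → Vertices → Carrier
  w p q = κ * 𝟙 (Graph._∼?_ Red p q)

  apply-w : ∀ f p → apply product-vertices w f p ≈ κ * ∑ (Graph.neighbours Red p) f
  apply-w f p = begin
    ∑ product-vertices (λ q → κ * 𝟙 (Graph._∼?_ Red p q) * f q)
      ≈⟨ ∑-cong product-vertices (λ q _ → *-assoc _ _ _) ⟩
    ∑ product-vertices (λ q → κ * (𝟙 (Graph._∼?_ Red p q) * f q))
      ≈⟨ ∑-*ˡ product-vertices κ _ ⟩
    κ * ∑ product-vertices (λ q → 𝟙 (Graph._∼?_ Red p q) * f q)
      ≈⟨ *-congˡ (∑-filter (Graph._∼?_ Red p) product-vertices f) ⟨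
    κ * ∑ (Graph.neighbours Red p) f ∎

  P-R≈w : ∀ f p → p ∈ product-vertices → P-R f p ≈ apply product-vertices w f p
  P-R≈w f p p∈ = trans (*-congʳ (reflexive (≡.cong (λ k → fromℕ k ⁻¹) (length-red p∈)))) (sym (apply-w f p))

  P-B≈blue : ∀ f p → p ∈ product-vertices → P-B f p ≈ f (blue p)
  P-B≈blue f p p∈ = begin
    fromℕ (length (Graph.neighbours Blue p)) ⁻¹ * ∑ (Graph.neighbours Blue p) f
      ≈⟨ *-cong (reflexive (≡.cong (λ k → fromℕ k ⁻¹) (↭-length (blue-neighbours p∈)))) (∑-↭ f (blue-neighbours p∈)) ⟩
    fromℕ 1 ⁻¹ * (f (blue p) + 0#)
      ≈⟨ solve 2 (λ i x → i :* (x :+ con (+ 0)) := (i :* (con (+ 1) :+ con (+ 0))) :* x) refl _ _ ⟩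
    fromℕ 1 ⁻¹ * fromℕ 1 * f (blue p)
      ≈⟨ *-congʳ (⁻¹-inverseˡ (fromℕ 1) (0<⇒≉0 (0<fromℕ 0))) ⟩
    1# * f (blue p)
      ≈⟨ *-identityˡ _ ⟩
    f (blue p) ∎

  w-stochastic : ∀ {τ} → SS.Edge τ → IsSymmetricStochastic w
  w-stochastic edge = record
    { symmetric = λ p q → *-congˡ (reflexive (𝟙-cong (Graph._∼?_ Red p q) (Graph._∼?_ Red q p) red-sym red-sym))
    ; nonNeg    = λ p q → *-nonNeg (⁻¹-nonNeg (0<m edge)) (𝟙-nonNeg (Graph._∼?_ Red p q))
    ; row-sum   = λ p p∈ → begin
        ∑ product-vertices (w p)
          ≈⟨ ∑-cong product-vertices (λ q _ → *-identityʳ _) ⟨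
        apply product-vertices w (λ _ → 1#) p
          ≈⟨ apply-w (λ _ → 1#) p ⟩
        κ * ∑ (Graph.neighbours Red p) (λ _ → 1#)
          ≈⟨ *-congˡ (reflexive (≡.trans (∑-one (Graph.neighbours Red p)) (≡.cong fromℕ (length-red p∈)))) ⟩
        κ * fromℕ m
          ≈⟨ ⁻¹-inverseˡ (fromℕ m) (0<⇒≉0 (0<m edge)) ⟩
        1# ∎
    }

  zigzag≈ : ∀ f p → p ∈ product-vertices →
            zigzag ℝ f p ≈ apply product-vertices w (apply product-vertices w f ∘ blue) p
  zigzag≈ f p p∈ = trans (P-R≈w _ p p∈) (apply-cong product-vertices w
    (λ q q∈ → trans (P-B≈blue (P-R f) q q∈) (P-R≈w f (blue q) (blue∈ q∈))) p)

  fromℕ-+ : ∀ j k → fromℕ (j ℕ.+ k) ≈ fromℕ j + fromℕ k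
  fromℕ-+ zero    k = sym (+-identityˡ _)
  fromℕ-+ (suc j) k = trans (+-congˡ (fromℕ-+ j k)) (sym (+-assoc _ _ _))

  -- The `m + m` neighbours split into two halves of equal size, so the average over all of them is
  -- the mean of the averages over the halves, each a red average at one presentation.
  walk≈ : ∀ f p → p ∈ product-vertices → let F = f ∘ act in
          normalizedAdjacency (Faces.G-walk Sc) f (act p) ≈ ½ * (apply product-vertices w F p + apply product-vertices w F (blue p))
  walk≈ f p@(g , τ) p∈ = begin
    fromℕ (length (WC.neighbours (τ · g))) ⁻¹ * ∑ (WC.neighbours (τ · g)) f
      ≈⟨ *-cong (reflexive (≡.cong (λ k → fromℕ k ⁻¹) length-walk)) sum-walk ⟩
    fromℕ (m ℕ.+ m) ⁻¹ * (a + b)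
      ≈⟨ *-congʳ inverse-double ⟩
    ½ * κ * (a + b)
      ≈⟨ solve 4 (λ h k a b → (h :* k) :* (a :+ b) := h :* (k :* a :+ k :* b)) refl ½ κ a b ⟩
    ½ * (κ * a + κ * b)
      ≈⟨ *-congˡ (+-cong (red-sum p) (red-sum (blue p))) ⟩
    ½ * (apply product-vertices w F p + apply product-vertices w F (blue p)) ∎
    where
    F = f ∘ act
    edge = ∈product⁻ p∈
    a = ∑ (WS.neighbours τ) (λ τ′ → f (τ′ · g))
    b = ∑ (WS.neighbours (inv τ)) (λ τ′ → f (τ′ · hat τ g))

    length-walk : length (WC.neighbours (τ · g)) ≡ m ℕ.+ m
    length-walk = ≡.trans (↭-length (walk-neighbours g edge)) (≡.trans (length-++ (map (_· g) (WS.neighbours τ)))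
      (≡.cong₂ ℕ._+_ (≡.trans (length-map _ (WS.neighbours τ)) (length-L edge))
                     (≡.trans (length-map _ (WS.neighbours (inv τ))) (length-L (inv-edge edge)))))

    sum-walk : ∑ (WC.neighbours (τ · g)) f ≈ a + b
    sum-walk = trans (∑-↭ f (walk-neighbours g edge)) (trans (∑-++ (map (_· g) (WS.neighbours τ)) _ f)
      (+-cong (reflexive (∑-map (_· g) (WS.neighbours τ) f)) (reflexive (∑-map (_· hat τ g) (WS.neighbours (inv τ)) f))))

    m≉0 = 0<⇒≉0 (0<m edge)
    2m≉0 : fromℕ (m ℕ.+ m) ≉ 0#
    2m≉0 eq = 0<m edge (≤-by (0≤fromℕ m) (trans (solve 1 (λ x → con (+ 0) :+ :- x := x :+ :- (x :+ x)) refl (fromℕ m))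
      (trans (+-congˡ (-‿cong (trans (sym (fromℕ-+ m m)) eq))) (solve 1 (λ x → x :+ :- con (+ 0) := x) refl (fromℕ m)))))
    inverse-double : fromℕ (m ℕ.+ m) ⁻¹ ≈ ½ * κ
    inverse-double = *-cancelˡ 2m≉0 (trans (⁻¹-inverseʳ _ 2m≉0) (sym (begin
      fromℕ (m ℕ.+ m) * (½ * κ)
        ≈⟨ *-congʳ (fromℕ-+ m m) ⟩
      (fromℕ m + fromℕ m) * (½ * κ)
        ≈⟨ solve 3 (λ x h k → (x :+ x) :* (h :* k) := (h :+ h) :* (k :* x)) refl (fromℕ m) ½ κ ⟩
      (½ + ½) * (κ * fromℕ m)
        ≈⟨ *-cong ½+½≈1 (⁻¹-inverseˡ (fromℕ m) m≉0) ⟩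
      1# * 1#
        ≈⟨ *-identityˡ 1# ⟩
      1# ∎)))

    red-sum : ∀ q → κ * ∑ (WS.neighbours (proj₂ q)) (λ τ′ → F (proj₁ q , τ′)) ≈ apply product-vertices w F q
    red-sum q@(h , ρ) = sym (trans (apply-w F q) (*-congˡ (trans (∑-↭ F (red-neighbours h ρ)) (reflexive (∑-map (h ,_) (WS.neighbours ρ) F)))))

  -- This is what makes the lift of a nontrivial eigenfunction orthogonal to the constants on the
  -- product.
  ∑-lift : ∀ f → ∑ product-vertices (f ∘ act) ≈ ∑ (Faces.edges Sc) f + ∑ (Faces.edges Sc) f
  ∑-lift f = begin
    ∑ product-vertices F
      ≈⟨ ∑-↭ F product-presentations ⟩
    ∑ (map presentation es ++ map (blue ∘ presentation) es) F
      ≈⟨ ∑-++ (map presentation es) _ F ⟩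
    ∑ (map presentation es) F + ∑ (map (blue ∘ presentation) es) F
      ≈⟨ +-cong (reflexive (∑-map presentation es F)) (reflexive (∑-map (blue ∘ presentation) es F)) ⟩
    ∑ es (F ∘ presentation) + ∑ es (F ∘ blue ∘ presentation)
      ≈⟨ +-cong (∑-cong es (λ e e∈ → reflexive (≡.cong f (proj₂ (presentation-correct e∈)))))
                (∑-cong es (λ e e∈ → reflexive (≡.cong f (≡.trans (act-blue _ (∈product⁻ (proj₁ (presentation-correct e∈))))
                  (proj₂ (presentation-correct e∈)))))) ⟩
    ∑ es f + ∑ es f ∎
    where
    F = f ∘ act
    es = Faces.edges Sc

  eigenvalue-bound : ∀ {λ₁ λ₂} → IsλWalk ℝ λ₁ → IsλZigzag ℝ λ₂ → λ₁ * λ₁ ≤ ½ + ½ * λ₂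
  eigenvalue-bound {λ₁} ((f , (e , e∈ , fe≉0) , ∑f≈0 , eigen) , _) (_ , λ₂-max) =
    ZigZag.half-walk-bound (w-stochastic edge) blue blue∈ (λ p∈ → blue-blue _ (∈product⁻ p∈)) zigzag≈ λ₂-max
      (presentation e , p∈ , λ eq → fe≉0 (trans (reflexive (≡.cong f (≡.sym act-p≡e))) eq))
      (trans (∑-lift f) (trans (+-cong ∑f≈0 ∑f≈0) (+-identityˡ 0#)))
      (λ { (g , τ) q∈ → trans (sym (eigen (τ · g) (WC.∈edges⁺ (edge⁺ g (∈product⁻ q∈))))) (walk≈ f (g , τ) q∈) })
    where
    p∈ = proj₁ (presentation-correct e∈)
    act-p≡e = proj₂ (presentation-correct e∈)
    edge = ∈product⁻ p∈

mainTheorem2 : (ℝ : RealNumbers) (G : FiniteGroup) (S : SetFamily (FiniteGroup.order G)) →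
    Is2DimComplex S →
    CTS.IsCommutativeTripletStructure G S →
    let open RealNumbers ℝ in
    ∀ λ₁ λ₂ → CTS.IsλWalk G S ℝ λ₁ → CTS.IsλZigzag G S ℝ λ₂ →
    ∃[ s ] (IsSqrt (½ + ½ * λ₂) s × λ₁ ≤ s)
mainTheorem2 ℝ G S complex cts λ₁ λ₂ walk zigzag =
  -- The radicand is nonnegative because it dominates the square of `λ₁`, so a root exists.
  let s , 0≤s , ss≈ = sqrt (½ + ½ * λ₂) (≤-trans (x*x-nonNeg λ₁) bound) in
  s , (0≤s , ss≈) , ≤-sqrt 0≤s (≤-respʳ (sym ss≈) bound)
  where
  open OrderedField ℝ
  bound = Lift.eigenvalue-bound ℝ G S complex cts walk zigzag
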